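{- Let $n \ge 2$ and consider an instance with key set $\mathcal{K}=\{1,2,\ldots,n\}$ and non-negative weights $w_1,\ldots,w_n$, with total weight $W=\sum_{k=1}^n w_k$. If $\max_{k} w_k \ge \tfrac{3}{7}W$, then there exists an optimal two-way comparison search tree for this instance whose root is an equal-to test. In other words, $\lambda^+ \le \tfrac{3}{7}$.
   Context: A two-way comparison search tree (2WCST) for the key set $\mathcal{K}=\{1,\ldots,n\}$ is a rooted binary tree in which every internal node is either an equal-to test $\langle = k\rangle$ (asking whether the query $q$ equals $k$) or a less-than test $\langle < k\rangle$ (asking whether $q<k$), for some key $k$, each internal node having a "yes" child and a "no" child, and every leaf is labeled by a key. The search for a query $q\in\mathcal{K}$ starts at the root and follows the branches given by the test outcomes; the tree is required to be correct, i.e. for every $q\in\mathcal{K}$ the search ends at a leaf labeled $q$ (successful-query model). Writing $\mathrm{depth}(k)$ for the depth of the leaf reached by the search for key $k$, the cost of a tree $T$ is $\mathrm{cost}(T)=\sum_{k\in\mathcal{K}} w_k\,\mathrm{depth}(k)$, and a tree is optimal if it has minimum cost among all 2WCSTs for the instance. The threshold $\lambda^+$ is defined as the smallest $\lambda$ such that, for every instance (with $n\ge 2$ keys), if some key has weight at least $\lambda W$ then there is an optimal 2WCST with an equal-to test at the root.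
   Formalization: The weights w_1,…,w_n are taken to be non-negative rational numbers instead of non-negative real numbers. -}

module Defs where

open import Data.Nat using (ℕ; suc; zero)
open import Data.Fin using (Fin; _≟_; _<?_)
open import Data.Product using (_×_; _,_; Σ; proj₁; proj₂)
open import Data.Rational using (ℚ; 0ℚ; _+_; _*_; _≤_; _/_)
open import Relation.Binary.PropositionalEquality using (_≡_)
open import Relation.Nullary using (yes; no)
import Data.Rational as Q
import Data.Integer

-- Keys are Fin n, i.e. key i+1 is represented by i : Fin n (order preserved).
-- A two-way comparison search tree over keys Fin n.
data Tree (n : ℕ) : Set where
  leaf  : Fin n → Tree n
  eqT   : Fin n → (yes no : Tree n) → Tree n
  ltT   : Fin n → (yes no : Tree n) → Tree n

search : ∀ {n} → Tree n → Fin n → Fin n × ℕ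
search (leaf k) q = k , 0
search (eqT k t u) q with q ≟ k
... | yes _ = let r = search t q in proj₁ r , suc (proj₂ r)
... | no  _ = let r = search u q in proj₁ r , suc (proj₂ r)
search (ltT k t u) q with q <? k
... | yes _ = let r = search t q in proj₁ r , suc (proj₂ r)
... | no  _ = let r = search u q in proj₁ r , suc (proj₂ r)

depth : ∀ {n} → Tree n → Fin n → ℕ
depth t q = proj₂ (search t q)

Correct : ∀ {n} → Tree n → Set
Correct t = ∀ q → proj₁ (search t q) ≡ q

sumFin : ∀ n → (Fin n → ℚ) → ℚ
sumFin zero f = 0ℚ
sumFin (suc n) f = f Fin.zero + sumFin n (λ i → f (Fin.suc i))
  where import Data.Fin as Fin

cost : ∀ {n} → (Fin n → ℚ) → Tree n → ℚ
cost {n} w t = sumFin n (λ q → w q * ((Data.Integer.+ depth t q) / 1))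

Optimal : ∀ {n} → (Fin n → ℚ) → Tree n → Set
Optimal w t = Correct t × (∀ t' → Correct t' → cost w t ≤ cost w t')

RootIsEqualTo : ∀ {n} → Tree n → Set
RootIsEqualTo (eqT _ _ _) = Data.Unit.⊤ where import Data.Unit
RootIsEqualTo (leaf _)    = Data.Empty.⊥ where import Data.Empty
RootIsEqualTo (ltT _ _ _) = Data.Empty.⊥ where import Data.Empty

-- Let k be a heaviest key, of weight 3θ, and let the total weight be at most 7θ. A tree whose root tests for
-- some j ≠ k has, by induction, a test for k next, and the two tests can be exchanged. A tree whose root
-- compares with a cut has, by induction, a test for k at the root of one side; let L be the rest of that
-- side and R the other side. Moving the test for k to the root saves cost 3θ on k, and it remains to search
-- L ∪ R at an extra cost of at most 3θ. If R weighs at most 3θ, a cut between L and R does it. Otherwise L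
-- weighs at most θ, and L is merged with the tree of R by rearranging the top two or three tests of the
-- latter. The rearrangements rest on the fact that restricting a tree to the two sides of any cut saves at
-- least the weight of the lighter side.

module Submission where

open import Defs
open import Data.Empty using (⊥-elim)
open import Data.Fin using (Fin; _<_; _≟_; _<?_)
import Data.Fin.Properties as Fin
open import Data.Integer using (+_)
import Data.Integer as ℤ
import Data.Integer.Properties as ℤ
open import Data.List using (List; []; _∷_; [_]; _++_; _∷ʳ_; length; reverse; tabulate; allFin)
import Data.Rational.Properties as ℚ
open import Relation.Binary.Bundles using (DecTotalOrder)
open import Data.List.Extrema (DecTotalOrder.totalOrder ℚ.≤-decTotalOrder) using (argmax; f[xs]≤f[argmax])
open import Data.List.Membership.Propositional using (_∈_)
open import Data.List.Membership.Propositional.Properties using (∈-∃++; ∈-allFin)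
open import Data.List.Properties
  using (++-assoc; ++-identityʳ; ++-conicalˡ; ++-conicalʳ; ∷-injective; length-++; length-++-sucʳ;
         length-reverse; length-tabulate; reverse-++; reverse-involutive; unfold-reverse)
open import Data.List.Relation.Unary.All using (All; []; _∷_)
import Data.List.Relation.Unary.All as All
import Data.List.Relation.Unary.All.Properties as All
open import Data.List.Relation.Unary.AllPairs using (AllPairs; []; _∷_)
import Data.List.Relation.Unary.AllPairs.Properties as AllPairs
open import Data.Nat using (ℕ; zero; suc; z≤n; s≤s; _≥_)
import Data.Nat as ℕ
import Data.Nat.Properties as ℕ
open import Data.Product using (Σ; ∃; ∃₂; _×_; _,_; proj₁; proj₂)
open import Data.Rational using (ℚ; 0ℚ; 1ℚ; _≤_; _*_; _/_; _+_; -_; nonNegative; toℚᵘ)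
open import Data.Rational.Properties
  using (≤-refl; ≤-reflexive; ≤-trans; ≤-total; +-mono-≤; +-monoʳ-≤; +-identityˡ; +-identityʳ; +-inverseʳ;
         +-assoc; +-comm; *-monoˡ-≤-nonNeg; *-zeroʳ; *-identityʳ; *-distribˡ-+; nonNegative⁻¹; normalize-nonNeg;
         toℚᵘ-injective; toℚᵘ-fromℚᵘ; toℚᵘ-homo-+; module ≤-Reasoning)
open import Data.Rational.Solver using (module +-*-Solver)
import Data.Rational.Unnormalised as ℚᵘ
import Data.Rational.Unnormalised.Properties as ℚᵘ
open import Data.Sum using (_⊎_; inj₁; inj₂)
open import Data.Unit using (tt)
open import Function using (id; _∘_)
open import Relation.Binary.PropositionalEquality using (_≡_; _≢_; refl; sym; trans; cong; cong₂; subst; subst₂)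
open import Relation.Nullary using (¬_; yes; no)
open +-*-Solver using (solve; con; _:+_; _:*_; _:=_)

-- Linear inequalities over the rationals and splittings of lists

infixl 6 _⊕_
_⊕_ : ∀ {p q r s} → p ≤ q → r ≤ s → p + r ≤ q + s
_⊕_ = +-mono-≤

-- Here r ≤ s is the sum of the hypotheses of a linear argument and the equation is left to the ring solver.
linear : ∀ {p q r s} → r ≤ s → p + s ≡ q + r → p ≤ q
linear {p} {q} {r} {s} r≤s eq = begin
  p                ≡⟨ cancel p s ⟨
  (p + s) + (- s)  ≡⟨ cong (_+ (- s)) eq ⟩
  (q + r) + (- s)  ≤⟨ +-mono-≤ (+-monoʳ-≤ q r≤s) ≤-refl ⟩
  (q + s) + (- s)  ≡⟨ cancel q s ⟩
  q                ∎
  where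
  open ≤-Reasoning
  cancel : ∀ a b → (a + b) + (- b) ≡ a
  cancel a b = trans (+-assoc a b (- b)) (trans (cong (_+_ a) (+-inverseʳ b)) (+-identityʳ a))

-- Locates two cuts of one list relative to each other. Coinciding cuts fall under the first case,
-- with `us` empty, since the second case demands a key `a` between them.
++-overlap : ∀ {A : Set} (ys : List A) {zs} ps {qs} → ys ++ zs ≡ ps ++ qs →
  (∃ λ us → ps ≡ ys ++ us × zs ≡ us ++ qs) ⊎
  (∃₂ λ a us → ys ≡ ps ++ a ∷ us × qs ≡ a ∷ us ++ zs)
++-overlap [] ps eq = inj₁ (ps , refl , eq)
++-overlap (y ∷ ys) [] eq = inj₂ (y , ys , refl , sym eq)
++-overlap (y ∷ ys) (p ∷ ps) eq with ∷-injective eq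
... | refl , eq′ with ++-overlap ys ps eq′
... | inj₁ (us , refl , zs≡) = inj₁ (us , refl , zs≡)
... | inj₂ (a , us , refl , qs≡) = inj₂ (a , us , refl , qs≡)

-- Additive weights of lists

module Weight {A : Set} (w : A → ℚ) where

  weight : List A → ℚ
  weight [] = 0ℚ
  weight (a ∷ as) = w a + weight as

  weight-++ : ∀ xs ys → weight (xs ++ ys) ≡ weight xs + weight ys
  weight-++ [] ys = sym (+-identityˡ (weight ys))
  weight-++ (x ∷ xs) ys = trans (cong (_+_ (w x)) (weight-++ xs ys)) (sym (+-assoc (w x) (weight xs) (weight ys)))

  weight-insert : ∀ ys a zs → weight (ys ++ a ∷ zs) ≡ w a + weight (ys ++ zs)
  weight-insert ys a zs rewrite weight-++ ys (a ∷ zs) | weight-++ ys zs =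
    solve 3 (λ y a z → y :+ (a :+ z) := a :+ (y :+ z)) refl (weight ys) (w a) (weight zs)

  weight-reverse : ∀ xs → weight (reverse xs) ≡ weight xs
  weight-reverse [] = refl
  weight-reverse (x ∷ xs) rewrite unfold-reverse x xs | weight-insert (reverse xs) x [] | ++-identityʳ (reverse xs) =
    cong (_+_ (w x)) (weight-reverse xs)

  weight≥0 : (∀ a → 0ℚ ≤ w a) → ∀ xs → 0ℚ ≤ weight xs
  weight≥0 w≥0 [] = ≤-refl
  weight≥0 w≥0 (a ∷ as) = w≥0 a ⊕ weight≥0 w≥0 as

-- Search trees as cost bounds for lists of keys

module KeyLists {A : Set} (w : A → ℚ) (w≥0 : ∀ a → 0ℚ ≤ w a) where

  open Weight w public hiding (weight≥0)

  weight≥0 : ∀ xs → 0ℚ ≤ weight xs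
  weight≥0 = Weight.weight≥0 w w≥0

  -- xs ⇓ c: some tree for the increasing list of keys xs has cost at most c.
  -- A comparison may leave one of its two sides empty.
  data _⇓_ : List A → ℚ → Set where
    leaf : ∀ {xs c} → length xs ℕ.≤ 1 → 0ℚ ≤ c → xs ⇓ c
    eq : ∀ {xs c} ys a zs {d} → xs ≡ ys ++ a ∷ zs → (ys ++ zs) ⇓ d →
         weight xs + d ≤ c → xs ⇓ c
    lt : ∀ {xs c} ys zs {d e} → xs ≡ ys ++ zs → ys ⇓ d → zs ⇓ e →
         weight xs + (d + e) ≤ c → xs ⇓ c

  cost≥0 : ∀ {xs c} → xs ⇓ c → 0ℚ ≤ c
  cost≥0 (leaf _ c≥0) = c≥0
  cost≥0 {xs} (eq _ _ _ _ t h) = ≤-trans (weight≥0 xs ⊕ cost≥0 t) h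
  cost≥0 {xs} (lt _ _ _ t u h) = ≤-trans (weight≥0 xs ⊕ (cost≥0 t ⊕ cost≥0 u)) h

  weaken : ∀ {xs c d} → c ≤ d → xs ⇓ c → xs ⇓ d
  weaken c≤d (leaf l h) = leaf l (≤-trans h c≤d)
  weaken c≤d (eq ys a zs e t h) = eq ys a zs e t (≤-trans h c≤d)
  weaken c≤d (lt ys zs e t u h) = lt ys zs e t u (≤-trans h c≤d)

  -- Reversal exchanges the two sides of every comparison and keeps weights, so that results about a
  -- list on the left carry over to the right.
  mirror : ∀ {xs c} → xs ⇓ c → reverse xs ⇓ c
  mirror {xs} (leaf l h) = leaf (subst (ℕ._≤ 1) (sym (length-reverse xs)) l) h
  mirror {xs} (eq ys a zs refl t h) =
    eq (reverse zs) a (reverse ys)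
      (trans (reverse-++ ys (a ∷ zs))
        (trans (cong (_++ reverse ys) (unfold-reverse a zs)) (++-assoc (reverse zs) [ a ] (reverse ys))))
      (subst (_⇓ _) (reverse-++ ys zs) (mirror t))
      (subst (λ x → x + _ ≤ _) (sym (weight-reverse xs)) h)
  mirror {xs} (lt ys zs {d} {e} refl t u h) =
    lt (reverse zs) (reverse ys) (reverse-++ ys zs) (mirror u) (mirror t)
      (subst (_≤ _) (cong₂ _+_ (sym (weight-reverse xs)) (+-comm d e)) h)

  -- Restricting a tree to the two sides of a cut makes the root redundant on at least one of them.
  split : ∀ {xs c} ys zs s → s ≤ weight ys → s ≤ weight zs → xs ≡ ys ++ zs → xs ⇓ c →
    ∃₂ λ d e → ys ⇓ d × zs ⇓ e × d + e + s ≤ c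
  split [] zs s s≤ys s≤zs refl (leaf l h) =
    0ℚ , 0ℚ , leaf z≤n ≤-refl , leaf l ≤-refl , ≤-trans (≤-reflexive refl ⊕ s≤ys) h
  split (y ∷ []) [] s s≤ys s≤zs refl (leaf l h) =
    0ℚ , 0ℚ , leaf l ≤-refl , leaf z≤n ≤-refl , ≤-trans (≤-reflexive refl ⊕ s≤zs) h
  split (y ∷ []) (_ ∷ _) s s≤ys s≤zs refl (leaf (s≤s ()) h)
  split (y ∷ _ ∷ _) zs s s≤ys s≤zs refl (leaf (s≤s ()) h)
  split {c = c} ys zs s s≤ys s≤zs refl (eq ps a qs {d₀} e t h) with ++-overlap ys ps e
  -- The tested key lies in `zs`, so `ys` skips the root and saves `weight ys`, at least `s`.
  -- Further down the saving 0 is enough.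
  ... | inj₁ (us , refl , refl)
      with split ys (us ++ qs) 0ℚ (weight≥0 ys) (weight≥0 (us ++ qs)) (++-assoc ys us qs) t
  ... | d , f , u , v , df≤ = d , _ , u , eq us a qs refl v ≤-refl ,
    (linear (s≤ys ⊕ h ⊕ df≤ ⊕ ≤-reflexive (sym (weight-++ ys zs)))
      (solve 8 (λ d z f s y c d₀ yz →
        d :+ (z :+ f) :+ s :+ (y :+ c :+ d₀ :+ yz) :=
        c :+ (s :+ (yz :+ d₀) :+ (d :+ f :+ con 0ℚ) :+ (y :+ z)))
        refl d (weight zs) f s (weight ys) c d₀ (weight (ys ++ zs))))
  split {c = c} ys zs s s≤ys s≤zs refl (eq ps a qs {d₀} e t h) | inj₂ (_ , us , refl , refl)
      with split (ps ++ us) zs 0ℚ (weight≥0 (ps ++ us)) (weight≥0 zs) (sym (++-assoc ps us zs)) t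
  ... | d , f , u , v , df≤ = _ , f , eq ps a us refl u ≤-refl , v ,
    (linear (s≤zs ⊕ h ⊕ df≤ ⊕ ≤-reflexive (sym (weight-++ ys zs)))
      (solve 8 (λ y d f s z c d₀ yz →
        y :+ d :+ f :+ s :+ (z :+ c :+ d₀ :+ yz) :=
        c :+ (s :+ (yz :+ d₀) :+ (d :+ f :+ con 0ℚ) :+ (y :+ z)))
        refl (weight ys) d f s (weight zs) c d₀ (weight (ys ++ zs))))
  split {c = c} ys zs s s≤ys s≤zs refl (lt ps qs {d₁} {d₂} e t₁ t₂ h) with ++-overlap ys ps e
  ... | inj₁ (us , refl , refl) with split ys us 0ℚ (weight≥0 ys) (weight≥0 us) refl t₁
  ... | d , f , u , v , df≤ = d , _ , u , lt us qs refl v t₂ ≤-refl ,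
    (linear (s≤ys ⊕ h ⊕ df≤ ⊕ ≤-reflexive (sym (weight-++ ys zs)))
      (solve 9 (λ d z f d₂ s y c d₁ yz →
        d :+ (z :+ (f :+ d₂)) :+ s :+ (y :+ c :+ d₁ :+ yz) :=
        c :+ (s :+ (yz :+ (d₁ :+ d₂)) :+ (d :+ f :+ con 0ℚ) :+ (y :+ z)))
        refl d (weight zs) f d₂ s (weight ys) c d₁ (weight (ys ++ zs))))
  split {c = c} ys zs s s≤ys s≤zs refl (lt ps qs {d₁} {d₂} e t₁ t₂ h) | inj₂ (a , us , refl , refl)
      with split (a ∷ us) zs 0ℚ (weight≥0 (a ∷ us)) (weight≥0 zs) refl t₂
  ... | d , f , u , v , df≤ = _ , f , lt ps (a ∷ us) refl t₁ u ≤-refl , v ,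
    (linear (s≤zs ⊕ h ⊕ df≤ ⊕ ≤-reflexive (sym (weight-++ ys zs)))
      (solve 9 (λ y d₁ d f s z c d₂ yz →
        y :+ (d₁ :+ d) :+ f :+ s :+ (z :+ c :+ d₂ :+ yz) :=
        c :+ (s :+ (yz :+ (d₁ :+ d₂)) :+ (d :+ f :+ con 0ℚ) :+ (y :+ z)))
        refl (weight ys) d₁ d f s (weight zs) c d₂ (weight (ys ++ zs))))

  weight-prefix : ∀ xs ys → weight xs ≤ weight (xs ++ ys)
  weight-prefix xs ys =
    (linear (≤-reflexive (sym (weight-++ xs ys)) ⊕ weight≥0 ys)
      (solve 3 (λ x xy y →
        x :+ (xy :+ y) :=
        xy :+ (x :+ y :+ con 0ℚ))
        refl (weight xs) (weight (xs ++ ys)) (weight ys)))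

  weight-suffix : ∀ xs ys → weight ys ≤ weight (xs ++ ys)
  weight-suffix xs ys =
    (linear (≤-reflexive (sym (weight-++ xs ys)) ⊕ weight≥0 xs)
      (solve 3 (λ y xy x →
        y :+ (xy :+ x) :=
        xy :+ (x :+ y :+ con 0ℚ))
        refl (weight ys) (weight (xs ++ ys)) (weight xs)))

  weight-two : ∀ P f Q s S → weight (P ++ f ∷ Q ++ s ∷ S) ≡ w f + (w s + weight (P ++ Q ++ S))
  weight-two P f Q s S = trans (weight-insert P f (Q ++ s ∷ S)) (cong (_+_ (w f))
    (trans (cong weight (sym (++-assoc P Q (s ∷ S))))
      (trans (weight-insert (P ++ Q) s S) (cong (λ xs → w s + weight xs) (++-assoc P Q S)))))

  -- With the weight carried as an expression of its own, the costs of nested trees stay polynomials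
  -- in the weights of the pieces, as the ring solver requires.
  _∶_⇓_ : List A → ℚ → ℚ → Set
  xs ∶ x ⇓ c = weight xs ≡ x × xs ⇓ c

  cut : ∀ {ys zs y z d e} → ys ∶ y ⇓ d → zs ∶ z ⇓ e → (ys ++ zs) ∶ (y + z) ⇓ (y + z + (d + e))
  cut {ys} {zs} (refl , t) (refl , u) =
    weight-++ ys zs , lt ys zs refl t u (≤-reflexive (cong (_+ _) (weight-++ ys zs)))

  pick : ∀ ys a zs {us x d} → ys ++ zs ≡ us → us ∶ x ⇓ d → (ys ++ a ∷ zs) ∶ (w a + x) ⇓ (w a + x + d)
  pick ys a zs refl (refl , t) =
    weight-insert ys a zs , eq ys a zs refl t (≤-reflexive (cong (_+ _) (weight-insert ys a zs)))

  build : ∀ {xs ys x c d} → xs ∶ x ⇓ c → xs ≡ ys → c ≤ d → ys ⇓ d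
  build (_ , t) refl c≤d = weaken c≤d t

  -- Merging a list of keys into the tree of its right neighbour

  module Insertion (θ : ℚ) (θ≥0 : 0ℚ ≤ θ) (w≤3θ : ∀ a → w a ≤ θ + θ + θ) {L : List A} {a : ℚ} (l : L ⇓ a) where

    -- The cost a + b of searching L and R separately, plus the saving on a key of weight 3θ that shared
    -- its side of the root cut with L.
    Insertable : List A → ℚ → Set
    Insertable R b = (L ++ R) ⇓ (a + b + (θ + θ + θ) + weight L)

    -- A root cut adds `weight L + weight R`, and the allowance beyond `a + b` is 3θ + `weight L`.
    insert-light : ∀ R {b} → weight R ≤ θ + θ + θ → R ⇓ b → Insertable R b
    insert-light R {b} R≤3θ r = build (cut (refl , l) (refl , r)) refl
      (linear (R≤3θ)
        (solve 5 (λ x y a b θ →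
          x :+ y :+ (a :+ b) :+ (θ :+ θ :+ θ) :=
          a :+ b :+ (θ :+ θ :+ θ) :+ x :+ y)
          refl (weight L) (weight R) a b θ))

    -- The test for `j` stays at the root, and a cut between `L` and the other keys follows. The
    -- root adds `weight L`, and the cut adds at most 4θ - θ = 3θ.
    insert-heavy-eq : ∀ ys j zs {d b} → θ ≤ w j → weight L + weight (ys ++ j ∷ zs) ≤ θ + θ + θ + θ →
      (ys ++ zs) ⇓ d → weight (ys ++ j ∷ zs) + d ≤ b → Insertable (ys ++ j ∷ zs) b
    insert-heavy-eq ys j zs {d} {b} θ≤j H t h =
      build (pick (L ++ ys) j zs (++-assoc L ys zs) (cut (refl , l) (refl , t))) (++-assoc L ys (j ∷ zs))
      (linear (θ≤j ⊕ H ⊕ h ⊕ ≤-reflexive (sym (weight-insert ys j zs))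
               ⊕ ≤-reflexive (sym (weight-insert ys j zs)))
        (solve 8 (λ wj x g a d θ b y →
          wj :+ (x :+ g) :+ (x :+ g :+ (a :+ d)) :+ (wj :+ (θ :+ θ :+ θ :+ θ) :+ b :+ y :+ y) :=
          a :+ b :+ (θ :+ θ :+ θ) :+ x :+ (θ :+ (x :+ y) :+ (y :+ d) :+ (wj :+ g) :+ (wj :+ g)))
          refl (w j) (weight L) (weight (ys ++ zs)) a d θ b (weight (ys ++ j ∷ zs))))

    -- The lower cut of `R` becomes the root, between `L ++ B` and `C ++ D`. Each key of `L` meets
    -- two new tests and each key of `D` one more than before, while `B` and `C` keep their depths.
    insert-lt-lt : ∀ B C D {β γ δ p b} → weight L ≤ θ → weight D ≤ θ → B ⇓ β → C ⇓ γ → D ⇓ δ →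
      weight (B ++ C) + (β + γ) ≤ p → weight ((B ++ C) ++ D) + (p + δ) ≤ b → Insertable ((B ++ C) ++ D) b
    insert-lt-lt B C D {β} {γ} {δ} {p} {b} L≤θ D≤θ t u v h h′ =
      build (cut (cut (refl , l) (refl , t)) (cut (refl , u) (refl , v)))
        (trans (++-assoc L B (C ++ D)) (cong (L ++_) (sym (++-assoc B C D))))
      (linear (L≤θ ⊕ D≤θ ⊕ θ≥0 ⊕ h ⊕ h′ ⊕ ≤-reflexive (sym (weight-++ B C))
               ⊕ ≤-reflexive (sym (weight-++ B C)) ⊕ ≤-reflexive (sym (weight-++ (B ++ C) D)))
        (solve 13 (λ x B C D a β γ δ θ p b BC BCD →
          x :+ B :+ (C :+ D) :+ (x :+ B :+ (a :+ β) :+ (C :+ D :+ (γ :+ δ))) :+ (θ :+ θ :+ θ :+ p :+ b :+ BC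
          :+ BC :+ BCD) :=
          a :+ b :+ (θ :+ θ :+ θ) :+ x :+ (x :+ D :+ con 0ℚ :+ (BC :+ (β :+ γ)) :+ (BCD :+ (p :+ δ)) :+ (B
          :+ C) :+ (B :+ C) :+ (BC :+ D)))
          refl (weight L) (weight B) (weight C) (weight D) a β γ δ θ p b (weight (B ++ C)) (weight ((B ++ C) ++ D))))

    -- The cut rises above the test for `j`, and `L` is then cut off from `C`. Only `L`, by two
    -- tests, and `j`, by one, become deeper.
    insert-eq-lt : ∀ C us j vs {γ δ p b} → weight L ≤ θ → w j ≤ θ → C ⇓ γ → (us ++ vs) ⇓ δ →
      weight (C ++ us ++ vs) + (γ + δ) ≤ p → weight (C ++ us ++ j ∷ vs) + p ≤ b → Insertable (C ++ us ++ j ∷ vs) b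
    insert-eq-lt C us j vs {γ} {δ} {p} {b} L≤θ j≤θ t u h h′ =
      build (cut (cut (refl , l) (refl , t)) (pick us j vs refl (refl , u))) (++-assoc L C (us ++ j ∷ vs))
      (linear (L≤θ ⊕ j≤θ ⊕ θ≥0 ⊕ h ⊕ h′ ⊕ ≤-reflexive (sym (weight-++ C (us ++ vs)))
               ⊕ ≤-reflexive (sym (weight-++ C (us ++ j ∷ vs))) ⊕ ≤-reflexive (sym (weight-insert us j vs)))
        (solve 13 (λ x C wj D a γ δ θ p b CD CjD jD →
          x :+ C :+ (wj :+ D) :+ (x :+ C :+ (a :+ γ) :+ (wj :+ D :+ δ)) :+ (θ :+ θ :+ θ :+ p :+ b :+ CD
          :+ CjD :+ jD) :=
          a :+ b :+ (θ :+ θ :+ θ) :+ x :+ (x :+ wj :+ con 0ℚ :+ (CD :+ (γ :+ δ)) :+ (CjD :+ p) :+ (C :+ D)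
          :+ (C :+ jD) :+ (wj :+ D)))
          refl (weight L) (weight C) (w j) (weight (us ++ vs)) a γ δ θ p b (weight (C ++ us ++ vs))
          (weight (C ++ us ++ j ∷ vs)) (weight (us ++ j ∷ vs))))

    -- The cut next to j goes on the side of j for which the lighter of G₁ and G₂ pays for the test.
    insert-around : ∀ G₁ j G₂ D {g δ b} → (G₁ ++ G₂) ⇓ g → D ⇓ δ →
      (w j + weight (G₁ ++ G₂) + weight D) + weight (G₁ ++ G₂) + (g + δ) + (weight L + w j + w j + weight D)
        ≤ b + (θ + θ + θ) →
      Insertable (G₁ ++ j ∷ G₂ ++ D) b
    insert-around G₁ j G₂ D {g} {δ} {b} t u h with ≤-total (weight G₂) (weight G₁)
    ... | inj₁ G₂≤G₁ with split G₁ G₂ (weight G₂) G₂≤G₁ ≤-refl refl t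
    ... | p , q , t₁ , t₂ , k =
      build (cut (cut (refl , l) (refl , t₁)) (cut (pick [] j G₂ refl (refl , t₂)) (refl , u)))
        (++-assoc L G₁ (j ∷ G₂ ++ D))
      (linear (h ⊕ k ⊕ ≤-reflexive (sym (weight-++ G₁ G₂)) ⊕ ≤-reflexive (sym (weight-++ G₁ G₂)))
        (solve 13 (λ x G₁ wj G₂ D a p q δ b θ g G →
          x :+ G₁ :+ (wj :+ G₂ :+ D) :+ (x :+ G₁ :+ (a :+ p) :+ (wj :+ G₂ :+ D :+ (wj :+ G₂ :+ q :+ δ)))
          :+ (b :+ (θ :+ θ :+ θ) :+ g :+ G :+ G) :=
          a :+ b :+ (θ :+ θ :+ θ) :+ x :+ (wj :+ G :+ D :+ G :+ (g :+ δ) :+ (x :+ wj :+ wj :+ D) :+ (p :+ q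
          :+ G₂) :+ (G₁ :+ G₂) :+ (G₁ :+ G₂)))
          refl (weight L) (weight G₁) (w j) (weight G₂) (weight D) a p q δ b θ g (weight (G₁ ++ G₂))))
    insert-around G₁ j G₂ D {g} {δ} {b} t u h | inj₂ G₁≤G₂ with split G₁ G₂ (weight G₁) ≤-refl G₁≤G₂ refl t
    ... | p , q , t₁ , t₂ , k =
      build (cut (cut (refl , l) (pick G₁ j [] (++-identityʳ G₁) (refl , t₁))) (cut (refl , t₂) (refl , u)))
        (trans (++-assoc L (G₁ ∷ʳ j) (G₂ ++ D)) (cong (L ++_) (++-assoc G₁ [ j ] (G₂ ++ D))))
      (linear (h ⊕ k ⊕ ≤-reflexive (sym (weight-++ G₁ G₂)) ⊕ ≤-reflexive (sym (weight-++ G₁ G₂)))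
        (solve 13 (λ x wj G₁ G₂ D a p q δ b θ g G →
          x :+ (wj :+ G₁) :+ (G₂ :+ D) :+ (x :+ (wj :+ G₁) :+ (a :+ (wj :+ G₁ :+ p)) :+ (G₂ :+ D :+ (q
          :+ δ))) :+ (b :+ (θ :+ θ :+ θ) :+ g :+ G :+ G) :=
          a :+ b :+ (θ :+ θ :+ θ) :+ x :+ (wj :+ G :+ D :+ G :+ (g :+ δ) :+ (x :+ wj :+ wj :+ D) :+ (p :+ q
          :+ G₁) :+ (G₁ :+ G₂) :+ (G₁ :+ G₂)))
          refl (weight L) (w j) (weight G₁) (weight G₂) (weight D) a p q δ b θ g (weight (G₁ ++ G₂))))

    -- The two inequalities are for the cuts just before and just after f, respectively.
    insert-eq-eq : ∀ P f Q s S {e b} → (P ++ Q ++ S) ⇓ e →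
      (w f + (w s + weight (P ++ Q ++ S))) + weight (P ++ Q ++ S) + e + (weight L + w f + (w s + w s))
        ≤ b + (θ + θ + θ) →
      (w f + (w s + weight (P ++ Q ++ S))) + weight (P ++ Q ++ S) + e + (weight L + (w f + w f) + w s)
        ≤ b + (θ + θ + θ) →
      Insertable (P ++ f ∷ Q ++ s ∷ S) b
    insert-eq-eq P f Q s S {e} {b} t h h′ with ≤-total (weight (Q ++ S)) (weight P)
    ... | inj₁ QS≤P with split P (Q ++ S) (weight (Q ++ S)) QS≤P ≤-refl refl t
    ... | p , q , t₁ , t₂ , k =
      build (cut (cut (refl , l) (refl , t₁)) (pick [] f (Q ++ s ∷ S) refl (pick Q s S refl (refl , t₂))))
        (++-assoc L P (f ∷ Q ++ s ∷ S))
      (linear (h ⊕ k ⊕ ≤-reflexive (sym (weight-++ P (Q ++ S))) ⊕ ≤-reflexive (sym (weight-++ P (Q ++ S))))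
        (solve 12 (λ x P wf ws QS a p q b θ e E →
          x :+ P :+ (wf :+ (ws :+ QS)) :+ (x :+ P :+ (a :+ p) :+ (wf :+ (ws :+ QS) :+ (ws :+ QS :+ q)))
          :+ (b :+ (θ :+ θ :+ θ) :+ e :+ E :+ E) :=
          a :+ b :+ (θ :+ θ :+ θ) :+ x :+ (wf :+ (ws :+ E) :+ E :+ e :+ (x :+ wf :+ (ws :+ ws)) :+ (p :+ q
          :+ QS) :+ (P :+ QS) :+ (P :+ QS)))
          refl (weight L) (weight P) (w f) (w s) (weight (Q ++ S)) a p q b θ e (weight (P ++ Q ++ S))))
    insert-eq-eq P f Q s S {e} {b} t h h′ | inj₂ P≤QS with split P (Q ++ S) (weight P) ≤-refl P≤QS refl t
    ... | p , q , t₁ , t₂ , k =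
      build (cut (cut (refl , l) (pick P f [] (++-identityʳ P) (refl , t₁))) (pick Q s S refl (refl , t₂)))
        (trans (++-assoc L (P ∷ʳ f) (Q ++ s ∷ S)) (cong (L ++_) (++-assoc P [ f ] (Q ++ s ∷ S))))
      (linear (h′ ⊕ k ⊕ ≤-reflexive (sym (weight-++ P (Q ++ S))) ⊕ ≤-reflexive (sym (weight-++ P (Q ++ S))))
        (solve 12 (λ x wf P ws QS a p q b θ e E →
          x :+ (wf :+ P) :+ (ws :+ QS) :+ (x :+ (wf :+ P) :+ (a :+ (wf :+ P :+ p)) :+ (ws :+ QS :+ q)) :+ (b
          :+ (θ :+ θ :+ θ) :+ e :+ E :+ E) :=
          a :+ b :+ (θ :+ θ :+ θ) :+ x :+ (wf :+ (ws :+ E) :+ E :+ e :+ (x :+ (wf :+ wf) :+ ws) :+ (p :+ q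
          :+ P) :+ (P :+ QS) :+ (P :+ QS)))
          refl (weight L) (w f) (weight P) (w s) (weight (Q ++ S)) a p q b θ e (weight (P ++ Q ++ S))))

    -- `f` and `s` are named by their order in the list; the disjunction says which of them the root
    -- tests, and that this key is light. If the other key weighs at least θ, exchanging the tests
    -- does not raise the cost and gives a heavy root. Otherwise both are light and a cut next to
    -- `f` becomes the root.
    insert-two-eqs : ∀ P f Q s S {e b} → weight L ≤ θ → weight L + weight (P ++ f ∷ Q ++ s ∷ S) ≤ θ + θ + θ + θ →
      (P ++ Q ++ S) ⇓ e →
      (w f ≤ θ × (w f + (w s + weight (P ++ Q ++ S))) + (w s + weight (P ++ Q ++ S)) + e ≤ b) ⊎
      (w s ≤ θ × (w f + (w s + weight (P ++ Q ++ S))) + (w f + weight (P ++ Q ++ S)) + e ≤ b) →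
      Insertable (P ++ f ∷ Q ++ s ∷ S) b
    insert-two-eqs P f Q s S {e} {b} L≤θ H t (inj₁ (f≤θ , h)) with ≤-total θ (w s)
    ... | inj₁ θ≤s = subst (λ R → Insertable R b) (++-assoc P (f ∷ Q) (s ∷ S))
      (insert-heavy-eq (P ++ f ∷ Q) s S θ≤s
        (subst (λ R → weight L + weight R ≤ _) (sym (++-assoc P (f ∷ Q) (s ∷ S))) H)
        (proj₂ (subst (λ R → R ∶ w f + weight (P ++ Q ++ S) ⇓ (w f + weight (P ++ Q ++ S) + e))
          (sym (++-assoc P (f ∷ Q) S)) (pick P f (Q ++ S) refl (refl , t))))
      (linear (h ⊕ f≤θ ⊕ θ≤s ⊕ ≤-reflexive weight-R)
        (solve 7 (λ y wf E e b θ ws →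
          y :+ (wf :+ E :+ e) :+ (b :+ θ :+ ws :+ (wf :+ (ws :+ E))) :=
          b :+ (wf :+ (ws :+ E) :+ (ws :+ E) :+ e :+ wf :+ θ :+ y))
          refl (weight ((P ++ f ∷ Q) ++ s ∷ S)) (w f) (weight (P ++ Q ++ S)) e b θ (w s))))
      where
      weight-R : weight ((P ++ f ∷ Q) ++ s ∷ S) ≡ w f + (w s + weight (P ++ Q ++ S))
      weight-R = trans (cong weight (++-assoc P (f ∷ Q) (s ∷ S))) (weight-two P f Q s S)
    ... | inj₂ s≤θ = insert-eq-eq P f Q s S t
      (linear (h ⊕ L≤θ ⊕ s≤θ ⊕ f≤θ)
        (solve 7 (λ wf ws E e x b θ →
          wf :+ (ws :+ E) :+ E :+ e :+ (x :+ wf :+ (ws :+ ws)) :+ (b :+ θ :+ θ :+ θ) :=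
          b :+ (θ :+ θ :+ θ) :+ (wf :+ (ws :+ E) :+ (ws :+ E) :+ e :+ x :+ ws :+ wf))
          refl (w f) (w s) (weight (P ++ Q ++ S)) e (weight L) b θ))
      (linear (h ⊕ L≤θ ⊕ f≤θ ⊕ f≤θ)
        (solve 7 (λ wf ws E e x b θ →
          wf :+ (ws :+ E) :+ E :+ e :+ (x :+ (wf :+ wf) :+ ws) :+ (b :+ θ :+ θ :+ θ) :=
          b :+ (θ :+ θ :+ θ) :+ (wf :+ (ws :+ E) :+ (ws :+ E) :+ e :+ x :+ wf :+ wf))
          refl (w f) (w s) (weight (P ++ Q ++ S)) e (weight L) b θ))
    insert-two-eqs P f Q s S {e} {b} L≤θ H t (inj₂ (s≤θ , h)) with ≤-total θ (w f)
    ... | inj₁ θ≤f = insert-heavy-eq P f (Q ++ s ∷ S) θ≤f H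
        (proj₂ (subst (λ R → R ∶ w s + weight (P ++ Q ++ S) ⇓ (w s + weight (P ++ Q ++ S) + e))
          (++-assoc P Q (s ∷ S)) (pick (P ++ Q) s S (++-assoc P Q S) (refl , t))))
      (linear (h ⊕ s≤θ ⊕ θ≤f ⊕ ≤-reflexive (weight-two P f Q s S))
        (solve 7 (λ y ws E e b θ wf →
          y :+ (ws :+ E :+ e) :+ (b :+ θ :+ wf :+ (wf :+ (ws :+ E))) :=
          b :+ (wf :+ (ws :+ E) :+ (wf :+ E) :+ e :+ ws :+ θ :+ y))
          refl (weight (P ++ f ∷ Q ++ s ∷ S)) (w s) (weight (P ++ Q ++ S)) e b θ (w f)))
    ... | inj₂ f≤θ = insert-eq-eq P f Q s S t
      (linear (h ⊕ L≤θ ⊕ s≤θ ⊕ s≤θ)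
        (solve 7 (λ wf ws E e x b θ →
          wf :+ (ws :+ E) :+ E :+ e :+ (x :+ wf :+ (ws :+ ws)) :+ (b :+ θ :+ θ :+ θ) :=
          b :+ (θ :+ θ :+ θ) :+ (wf :+ (ws :+ E) :+ (wf :+ E) :+ e :+ x :+ ws :+ ws))
          refl (w f) (w s) (weight (P ++ Q ++ S)) e (weight L) b θ))
      (linear (h ⊕ L≤θ ⊕ f≤θ ⊕ s≤θ)
        (solve 7 (λ wf ws E e x b θ →
          wf :+ (ws :+ E) :+ E :+ e :+ (x :+ (wf :+ wf) :+ ws) :+ (b :+ θ :+ θ :+ θ) :=
          b :+ (θ :+ θ :+ θ) :+ (wf :+ (ws :+ E) :+ (wf :+ E) :+ e :+ x :+ wf :+ ws))
          refl (w f) (w s) (weight (P ++ Q ++ S)) e (weight L) b θ))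

    -- A light key at the root saves too little by itself, so the second test of the tree decides
    -- the rearrangement.
    insert-eq : ∀ ys j zs {d b} → weight L ≤ θ → θ + θ + θ ≤ weight (ys ++ j ∷ zs) →
      weight L + weight (ys ++ j ∷ zs) ≤ θ + θ + θ + θ → w j ≤ θ →
      (ys ++ zs) ⇓ d → weight (ys ++ j ∷ zs) + d ≤ b → Insertable (ys ++ j ∷ zs) b
    insert-eq [] j [] {d} {b} L≤θ 3θ≤R H j≤θ (leaf len d≥0) h =
      insert-light [ j ]
      (linear (j≤θ ⊕ θ≥0 ⊕ θ≥0)
        (solve 2 (λ wj θ →
          wj :+ con 0ℚ :+ (θ :+ θ :+ θ) :=
          θ :+ θ :+ θ :+ (wj :+ con 0ℚ :+ con 0ℚ))
          refl (w j) θ))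
      (leaf (s≤s z≤n)
      (linear (h ⊕ d≥0 ⊕ weight≥0 [ j ])
        (solve 3 (λ b d y →
          con 0ℚ :+ (b :+ d :+ y) :=
          b :+ (y :+ d :+ con 0ℚ :+ con 0ℚ))
          refl b d (weight [ j ]))))
    -- The key `g` weighs at least 3θ - θ, so the test for `g` can be the root in place of that for
    -- `j`.
    insert-eq [] j (g ∷ []) {d} {b} L≤θ 3θ≤R H j≤θ (leaf len d≥0) h =
      insert-heavy-eq [ j ] g []
      (linear (3θ≤R ⊕ j≤θ ⊕ θ≥0)
        (solve 3 (λ θ wj wg →
          θ :+ (wj :+ (wg :+ con 0ℚ) :+ θ :+ θ) :=
          wg :+ (θ :+ θ :+ θ :+ wj :+ con 0ℚ))
          refl θ (w j) (w g)))
      H (leaf (s≤s z≤n) ≤-refl)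
      (≤-trans (+-monoʳ-≤ (weight (j ∷ [ g ])) d≥0) h)
    insert-eq (g ∷ []) j [] {d} {b} L≤θ 3θ≤R H j≤θ (leaf len d≥0) h =
      insert-heavy-eq [] g [ j ]
      (linear (3θ≤R ⊕ j≤θ ⊕ θ≥0)
        (solve 3 (λ θ wg wj →
          θ :+ (wg :+ (wj :+ con 0ℚ) :+ θ :+ θ) :=
          wg :+ (θ :+ θ :+ θ :+ wj :+ con 0ℚ))
          refl θ (w g) (w j)))
      H (leaf (s≤s z≤n) ≤-refl)
      (≤-trans (+-monoʳ-≤ (weight (g ∷ [ j ])) d≥0) h)
    insert-eq [] j (_ ∷ _ ∷ _) L≤θ 3θ≤R H j≤θ (leaf (s≤s ()) _) h
    insert-eq (_ ∷ []) j (_ ∷ _) L≤θ 3θ≤R H j≤θ (leaf (s≤s ()) _) h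
    insert-eq (_ ∷ _ ∷ _) j _ L≤θ 3θ≤R H j≤θ (leaf (s≤s ()) _) h
    insert-eq ys j zs {d} {b} L≤θ 3θ≤R H j≤θ (eq es i gs {e} e≡ t h₁) h with ++-overlap ys es e≡
    ... | inj₁ (us , refl , refl) =
      insert-two-eqs ys j us i gs L≤θ H (subst (_⇓ _) (++-assoc ys us gs) t) (inj₁ (j≤θ ,
      (linear (h ⊕ h₁ ⊕ ≤-reflexive (sym (weight-insert ys j zs)) ⊕ ≤-reflexive (sym weight-G)
               ⊕ ≤-reflexive (sym weight-G))
        (solve 8 (λ wj wi E e b d y g →
          wj :+ (wi :+ E) :+ (wi :+ E) :+ e :+ (b :+ d :+ y :+ g :+ g) :=
          b :+ (y :+ d :+ (g :+ e) :+ (wj :+ g) :+ (wi :+ E) :+ (wi :+ E)))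
          refl (w j) (w i) (weight (ys ++ us ++ gs)) e b d (weight (ys ++ j ∷ zs)) (weight (ys ++ zs))))))
      where
      weight-G : weight (ys ++ us ++ i ∷ gs) ≡ w i + weight (ys ++ us ++ gs)
      weight-G = trans (cong weight (sym (++-assoc ys us (i ∷ gs))))
        (trans (weight-insert (ys ++ us) i gs) (cong (λ R → w i + weight R) (++-assoc ys us gs)))
    ... | inj₂ (_ , us , refl , refl) = subst (λ R → Insertable R b) (sym R≡)
      (insert-two-eqs es i us j zs L≤θ (subst (λ R → weight L + weight R ≤ _) R≡ H) t (inj₂ (j≤θ ,
      (linear (h ⊕ h₁ ⊕ ≤-reflexive (sym (weight-insert ys j zs)) ⊕ ≤-reflexive (sym weight-G)
               ⊕ ≤-reflexive (sym weight-G))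
        (solve 8 (λ wi wj E e b d y g →
          wi :+ (wj :+ E) :+ (wi :+ E) :+ e :+ (b :+ d :+ y :+ g :+ g) :=
          b :+ (y :+ d :+ (g :+ e) :+ (wj :+ g) :+ (wi :+ E) :+ (wi :+ E)))
          refl (w i) (w j) (weight (es ++ us ++ zs)) e b d (weight (ys ++ j ∷ zs)) (weight (ys ++ zs)))))))
      where
      R≡ : (es ++ i ∷ us) ++ j ∷ zs ≡ es ++ i ∷ us ++ j ∷ zs
      R≡ = ++-assoc es (i ∷ us) (j ∷ zs)
      weight-G : weight ((es ++ i ∷ us) ++ zs) ≡ w i + weight (es ++ us ++ zs)
      weight-G = trans (cong weight (++-assoc es (i ∷ us) zs)) (weight-insert es i (us ++ zs))
    insert-eq ys j zs {d} {b} L≤θ 3θ≤R H j≤θ (lt C D {γ} {δ} e≡ t u h₁) h with ++-overlap ys C e≡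
    -- Here `j` lies on the side of the cut next to `L`, and the requirement comes down to
    -- `weight L + w j + w j` being at most 3θ.
    ... | inj₁ (us , refl , refl) = insert-around ys j us D t u
      (linear (h ⊕ h₁ ⊕ L≤θ ⊕ j≤θ ⊕ j≤θ ⊕ ≤-reflexive (sym (weight-insert ys j zs))
               ⊕ ≤-reflexive (sym weight-G) ⊕ ≤-reflexive (sym weight-G))
        (solve 11 (λ wj G D γ δ x b d θ y g →
          wj :+ G :+ D :+ G :+ (γ :+ δ) :+ (x :+ wj :+ wj :+ D) :+ (b :+ d :+ θ :+ θ :+ θ :+ y :+ g :+ g) :=
          b :+ (θ :+ θ :+ θ) :+ (y :+ d :+ (g :+ (γ :+ δ)) :+ x :+ wj :+ wj :+ (wj :+ g) :+ (G :+ D) :+ (G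
          :+ D)))
          refl (w j) (weight (ys ++ us)) (weight D) γ δ (weight L) b d θ (weight (ys ++ j ∷ zs)) (weight (ys ++ zs))))
      where
      weight-G : weight (ys ++ us ++ D) ≡ weight (ys ++ us) + weight D
      weight-G = trans (cong weight (sym (++-assoc ys us D))) (weight-++ (ys ++ us) D)
    -- Here `j` lies beyond the cut, so the cut can rise above the test.
    ... | inj₂ (c , us , refl , refl) = subst (λ R → Insertable R b) (sym (++-assoc C (c ∷ us) (j ∷ zs)))
      (insert-eq-lt C (c ∷ us) j zs L≤θ j≤θ t u
        (subst (λ R → weight R + (γ + δ) ≤ d) (++-assoc C (c ∷ us) zs) h₁)
        (subst (λ R → weight R + d ≤ b) (++-assoc C (c ∷ us) (j ∷ zs)) h))

    -- Since `D` weighs at most θ and the whole at least 3θ, a single key in `C` weighs at least 2θ.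
    -- Testing for it costs no more than cutting it off.
    insert-short-lt : ∀ C D {p δ b} → weight L ≤ θ → θ + θ + θ ≤ weight (C ++ D) →
      weight L + weight (C ++ D) ≤ θ + θ + θ + θ → weight D ≤ θ →
      length C ℕ.≤ 1 → 0ℚ ≤ p → D ⇓ δ → weight (C ++ D) + (p + δ) ≤ b → Insertable (C ++ D) b
    insert-short-lt [] D {p} {δ} {b} L≤θ 3θ≤R H D≤θ _ p≥0 u h =
      insert-light D
      (linear (D≤θ ⊕ θ≥0 ⊕ θ≥0)
        (solve 2 (λ D θ →
          D :+ (θ :+ θ :+ θ) :=
          θ :+ θ :+ θ :+ (D :+ con 0ℚ :+ con 0ℚ))
          refl (weight D) θ))
      (weaken
      (linear (h ⊕ p≥0 ⊕ weight≥0 D)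
        (solve 4 (λ δ b p D →
          δ :+ (b :+ p :+ D) :=
          b :+ (D :+ (p :+ δ) :+ con 0ℚ :+ con 0ℚ))
          refl δ b p (weight D)))
      u)
    insert-short-lt (c ∷ []) D {p} {δ} {b} L≤θ 3θ≤R H D≤θ _ p≥0 u h =
      insert-heavy-eq [] c D
      (linear (3θ≤R ⊕ D≤θ ⊕ θ≥0)
        (solve 3 (λ θ wc D →
          θ :+ (wc :+ D :+ θ :+ θ) :=
          wc :+ (θ :+ θ :+ θ :+ D :+ con 0ℚ))
          refl θ (w c) (weight D)))
      H u
      (linear (h ⊕ p≥0)
        (solve 5 (λ wc D δ b p →
          wc :+ D :+ δ :+ (b :+ p) :=
          b :+ (wc :+ D :+ (p :+ δ) :+ con 0ℚ))
          refl (w c) (weight D) δ b p))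
    insert-short-lt (_ ∷ _ ∷ _) D L≤θ 3θ≤R H D≤θ (s≤s ()) p≥0 u h

    -- A light right side leaves the weight in `C`, so the second test inside `C` decides the
    -- rearrangement.
    insert-lt : ∀ C D {p δ b} → weight L ≤ θ → θ + θ + θ ≤ weight (C ++ D) →
      weight L + weight (C ++ D) ≤ θ + θ + θ + θ → weight D ≤ θ →
      C ⇓ p → D ⇓ δ → weight (C ++ D) + (p + δ) ≤ b → Insertable (C ++ D) b
    insert-lt C D L≤θ 3θ≤R H D≤θ (leaf len p≥0) u h = insert-short-lt C D L≤θ 3θ≤R H D≤θ len p≥0 u h
    insert-lt C D {p} {δ} {b} L≤θ 3θ≤R H D≤θ (eq ys j zs {g} refl t h₁) u h =
      subst (λ R → Insertable R b) (sym (++-assoc ys (j ∷ zs) D)) result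
      where
      weight-C : weight (ys ++ j ∷ zs) ≡ w j + weight (ys ++ zs)
      weight-C = weight-insert ys j zs
      weight-R : weight ((ys ++ j ∷ zs) ++ D) ≡ weight (ys ++ j ∷ zs) + weight D
      weight-R = weight-++ (ys ++ j ∷ zs) D
      result : Insertable (ys ++ j ∷ zs ++ D) b
      result with ≤-total θ (w j)
      -- Raising the test for `j` above the cut adds `weight D`, at most θ, and saves `w j`, at
      -- least θ.
      ... | inj₁ θ≤j = insert-heavy-eq ys j (zs ++ D) θ≤j
        (subst (λ R → weight L + weight R ≤ _) (++-assoc ys (j ∷ zs) D) H)
        (subst (_⇓ (weight (ys ++ zs) + weight D + (g + δ))) (++-assoc ys zs D) (proj₂ (cut (refl , t) (refl , u))))
        (subst (λ R → weight R + _ ≤ b) (++-assoc ys (j ∷ zs) D)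
        (linear (h ⊕ h₁ ⊕ D≤θ ⊕ θ≤j ⊕ ≤-reflexive (sym weight-C))
          (solve 10 (λ y G D g δ b p θ wj C →
            y :+ (G :+ D :+ (g :+ δ)) :+ (b :+ p :+ θ :+ wj :+ C) :=
            b :+ (y :+ (p :+ δ) :+ (C :+ g) :+ D :+ θ :+ (wj :+ G)))
            refl (weight ((ys ++ j ∷ zs) ++ D)) (weight (ys ++ zs)) (weight D) g δ b p θ (w j)
            (weight (ys ++ j ∷ zs)))))
      ... | inj₂ j≤θ = insert-around ys j zs D t u
        (linear (h ⊕ h₁ ⊕ D≤θ ⊕ j≤θ ⊕ L≤θ ⊕ ≤-reflexive (sym weight-C) ⊕ ≤-reflexive (sym weight-C)
                 ⊕ ≤-reflexive (sym weight-R))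
          (solve 11 (λ wj G D g δ x b p θ C y →
            wj :+ G :+ D :+ G :+ (g :+ δ) :+ (x :+ wj :+ wj :+ D) :+ (b :+ p :+ θ :+ θ :+ θ :+ C :+ C :+ y) :=
            b :+ (θ :+ θ :+ θ) :+ (y :+ (p :+ δ) :+ (C :+ g) :+ D :+ wj :+ x :+ (wj :+ G) :+ (wj :+ G) :+ (C
            :+ D)))
            refl (w j) (weight (ys ++ zs)) (weight D) g δ (weight L) b p θ (weight (ys ++ j ∷ zs))
            (weight ((ys ++ j ∷ zs) ++ D))))
    insert-lt C D L≤θ 3θ≤R H D≤θ (lt A B refl t t′ h₁) u h =
      insert-lt-lt A B D L≤θ D≤θ t t′ u h₁ h

    weight-short : ∀ R → length R ℕ.≤ 1 → weight R ≤ θ + θ + θ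
    weight-short [] _ = θ≥0 ⊕ θ≥0 ⊕ θ≥0
    weight-short (c ∷ []) _ = ≤-trans (≤-reflexive (+-identityʳ (w c))) (w≤3θ c)
    weight-short (_ ∷ _ ∷ _) (s≤s ())

    -- A list `R` of weight 3θ or more leaves at most θ for `L`, and the root of its tree decides
    -- the rearrangement. At a leaf, `w≤3θ` leads back to the light case.
    insert : ∀ R {b} → weight L + weight R ≤ θ + θ + θ + θ → R ⇓ b → Insertable R b
    insert R {b} H r with ≤-total (weight R) (θ + θ + θ)
    ... | inj₁ R≤3θ = insert-light R R≤3θ r
    ... | inj₂ 3θ≤R = go r
      where
      L≤θ : weight L ≤ θ
      L≤θ =
        (linear (H ⊕ 3θ≤R)
          (solve 3 (λ x θ y →
            x :+ (θ :+ θ :+ θ :+ θ :+ y) :=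
            θ :+ (x :+ y :+ (θ :+ θ :+ θ)))
            refl (weight L) θ (weight R)))
      go : R ⇓ b → Insertable R b
      go (leaf len _) = insert-light R (weight-short R len) r
      go (eq ys j zs refl t h) with ≤-total θ (w j)
      ... | inj₁ θ≤j = insert-heavy-eq ys j zs θ≤j H t h
      ... | inj₂ j≤θ = insert-eq ys j zs L≤θ 3θ≤R H j≤θ t h
      go (lt C D {p} {δ} refl t u h) with ≤-total θ (weight D)
      ... | inj₂ D≤θ = insert-lt C D L≤θ 3θ≤R H D≤θ t u h
      -- The root cut stays, and `L` is cut off from `C` below it. That cut costs
      -- `weight L + weight C`, at most 4θ - θ.
      ... | inj₁ θ≤D = build (cut (cut (refl , l) (refl , t)) (refl , u)) (++-assoc L C D)
        (linear (h ⊕ θ≤D ⊕ H ⊕ ≤-reflexive (sym (weight-++ C D)) ⊕ ≤-reflexive (sym (weight-++ C D)))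
          (solve 9 (λ x C D a p δ b θ y →
            x :+ C :+ D :+ (x :+ C :+ (a :+ p) :+ δ) :+ (b :+ D :+ (θ :+ θ :+ θ :+ θ) :+ y :+ y) :=
            a :+ b :+ (θ :+ θ :+ θ) :+ x :+ (y :+ (p :+ δ) :+ θ :+ (x :+ y) :+ (C :+ D) :+ (C :+ D)))
            refl (weight L) (weight C) (weight D) a p δ b θ (weight (C ++ D))))

  -- Existence of a least cost

  Least : List A → ℚ → Set
  Least xs c = xs ⇓ c × (∀ {d} → xs ⇓ d → c ≤ d)

  meet : ∀ {xs c d} → xs ⇓ c → xs ⇓ d → ∃ λ e → xs ⇓ e × e ≤ c × e ≤ d
  meet {c = c} {d} t u with ≤-total c d
  ... | inj₁ c≤d = c , t , ≤-refl , c≤d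
  ... | inj₂ d≤c = d , u , d≤c , ≤-refl

  -- c bounds from below every tree whose root separates ys from zs or removes the head of zs.
  Covers : List A → ℚ → List A → List A → Set
  Covers xs c ys zs =
    (∀ {b bs a as d e} → ys ≡ b ∷ bs → zs ≡ a ∷ as → ys ⇓ d → zs ⇓ e → c ≤ weight xs + (d + e)) ×
    (∀ {a as d} → zs ≡ a ∷ as → (ys ++ as) ⇓ d → c ≤ weight xs + d)

  covers-≤ : ∀ {xs c d} ys zs → c ≤ d → Covers xs d ys zs → Covers xs c ys zs
  covers-≤ _ _ c≤d (f , g) =
    (λ p q t u → ≤-trans c≤d (f p q t u)) , (λ p t → ≤-trans c≤d (g p t))

  module _ (xs : List A) (least : ∀ ys → length ys ℕ.< length xs → ∃ (Least ys)) where

    -- Two roots belong to this position: the test for `a` and the cut before it. With `ys` empty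
    -- the cut separates nothing, and only the test remains.
    least-at : ∀ ys a zs → xs ≡ ys ++ a ∷ zs → ∃ λ c → xs ⇓ c × Covers xs c ys (a ∷ zs)
    least-at ys a zs refl with least (ys ++ zs) (ℕ.≤-reflexive (sym (length-++-sucʳ ys a zs)))
    least-at [] a zs refl | d , t , d≤ =
      _ , eq [] a zs refl t ≤-refl , (λ ()) , λ { refl u → +-monoʳ-≤ (weight xs) (d≤ u) }
    least-at ys@(_ ∷ _) a zs refl | d , t , d≤
      with least ys (ℕ.≤-trans (ℕ.m<m+n (length ys) (s≤s z≤n)) (ℕ.≤-reflexive (sym (length-++ ys))))
         | least (a ∷ zs) (ℕ.≤-trans (ℕ.m<n+m (suc (length zs)) (s≤s z≤n)) (ℕ.≤-reflexive (sym (length-++ ys))))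
    ... | _ , u , e≤ | _ , v , f≤ with meet (eq ys a zs refl t ≤-refl) (lt ys (a ∷ zs) refl u v ≤-refl)
    ... | g , p , g≤eq , g≤lt = g , p ,
      (λ { refl refl t₁ t₂ → ≤-trans g≤lt (+-monoʳ-≤ (weight xs) (e≤ t₁ ⊕ f≤ t₂)) }) ,
      (λ { refl t₁ → ≤-trans g≤eq (+-monoʳ-≤ (weight xs) (d≤ t₁)) })

    least-from : ∀ ys a zs → xs ≡ ys ++ a ∷ zs →
      ∃ λ c → xs ⇓ c × (∀ us qs → a ∷ zs ≡ us ++ qs → Covers xs c (ys ++ us) qs)
    least-from ys a [] e with least-at ys a [] e
    ... | c , t , cov = c , t , λ where
      [] _ refl → subst (λ ps → Covers xs c ps [ a ]) (sym (++-identityʳ ys)) cov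
      (_ ∷ []) _ refl → (λ _ ()) , (λ ())
      (_ ∷ _ ∷ _) _ ()
    least-from ys a (b ∷ zs) e
      with least-at ys a (b ∷ zs) e | least-from (ys ∷ʳ a) b zs (trans e (sym (++-assoc ys [ a ] (b ∷ zs))))
    ... | c , t , cov | d , u , rest with meet t u
    ... | m , v , m≤c , m≤d = m , v , λ where
      [] _ refl → subst (λ ps → Covers xs m ps (a ∷ b ∷ zs)) (sym (++-identityʳ ys)) (covers-≤ {xs} ys (a ∷ b ∷ zs) m≤c cov)
      (_ ∷ us) qs e′ → covers-≤ {xs} (ys ++ _ ∷ us) qs m≤d (subst (λ ps → Covers xs d ps qs)
        (trans (++-assoc ys [ a ] us) (cong (λ k → ys ++ k ∷ us) (proj₁ (∷-injective e′))))
        (rest us qs (proj₂ (∷-injective e′))))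

    -- A comparison with an empty side only adds cost, so the bound is inherited from the other
    -- side; every other root is covered. The separate name `ys` for the list keeps the index of the
    -- tree free for the recursion.
    below : ∀ {ys c d} → 1 ℕ.< length xs → (∀ us qs → xs ≡ us ++ qs → Covers xs c us qs) →
      xs ≡ ys → ys ⇓ d → c ≤ d
    below 1< cov refl (leaf len _) = ⊥-elim (ℕ.<⇒≱ 1< len)
    below 1< cov refl (eq ps a qs e t h) = ≤-trans (proj₂ (cov ps (a ∷ qs) e) refl t) h
    below 1< cov refl (lt [] qs {d} {e} e≡ t u h) =
      ≤-trans (below 1< cov e≡ u)
        (≤-trans
        (linear (cost≥0 t ⊕ weight≥0 xs)
          (solve 3 (λ e d x →
            e :+ (d :+ x) :=
            x :+ (d :+ e) :+ (con 0ℚ :+ con 0ℚ))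
            refl e d (weight xs)))
        h)
    below 1< cov refl (lt ps@(_ ∷ _) [] {d} {e} e≡ t u h) =
      ≤-trans (below 1< cov (trans e≡ (++-identityʳ ps)) t)
        (≤-trans
        (linear (cost≥0 u ⊕ weight≥0 xs)
          (solve 3 (λ d e x →
            d :+ (e :+ x) :=
            x :+ (d :+ e) :+ (con 0ℚ :+ con 0ℚ))
            refl d e (weight xs)))
        h)
    below 1< cov refl (lt ps@(_ ∷ _) qs@(_ ∷ _) e≡ t u h) = ≤-trans (proj₁ (cov ps qs e≡) refl refl t u) h

  -- Vacuous comparisons allow infinitely many trees for one list, so the minimum must be shown to
  -- be attained. Only the finitely many roots that lead to shorter lists matter, and these lists
  -- have least costs by induction on `n`.
  least-bounded : ∀ n xs → length xs ℕ.≤ n → ∃ (Least xs)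
  least-bounded n [] _ = 0ℚ , leaf z≤n ≤-refl , cost≥0
  least-bounded n (x ∷ []) _ = 0ℚ , leaf (s≤s z≤n) ≤-refl , cost≥0
  least-bounded (suc n) xs@(x ∷ y ∷ zs) (s≤s len)
    with least-from xs (λ ys l → least-bounded n ys (ℕ.≤-trans (ℕ.s≤s⁻¹ l) len)) [] x (y ∷ zs) refl
  ... | c , t , cov = c , t , below xs (λ ys l → least-bounded n ys (ℕ.≤-trans (ℕ.s≤s⁻¹ l) len)) (s≤s (s≤s z≤n)) cov refl

  least-cost : ∀ xs → ∃ (Least xs)
  least-cost xs = least-bounded (length xs) xs ℕ.≤-refl

  -- Moving the test for a heaviest key to the root

  module Extraction (θ : ℚ) (θ≥0 : 0ℚ ≤ θ) (k : A) (wk≡3θ : w k ≡ θ + θ + θ) (w≤wk : ∀ a → w a ≤ w k) where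

    w≤3θ : ∀ a → w a ≤ θ + θ + θ
    w≤3θ a = ≤-trans (w≤wk a) (≤-reflexive wk≡3θ)

    3θ≤wk : θ + θ + θ ≤ w k
    3θ≤wk = ≤-reflexive (sym wk≡3θ)

    7θ : ℚ
    7θ = θ + θ + θ + θ + θ + θ + θ

    -- Insertion to the right of `R`, obtained by reversing all lists and trees.
    insertʳ : ∀ R L {a b} → weight L + weight R ≤ θ + θ + θ + θ → L ⇓ a → R ⇓ b →
      (R ++ L) ⇓ (a + b + (θ + θ + θ) + weight L)
    insertʳ R L {a} {b} H l r =
      subst (_⇓ (a + b + (θ + θ + θ) + weight L)) (reverse-involutive (R ++ L))
        (mirror (subst₂ (λ xs x → xs ⇓ (a + b + (θ + θ + θ) + x)) (sym (reverse-++ R L)) (weight-reverse L)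
          (Insertion.insert θ θ≥0 w≤3θ (mirror l) (reverse R)
            (subst₂ (λ x y → x + y ≤ θ + θ + θ + θ) (sym (weight-reverse L)) (sym (weight-reverse R)) H)
            (mirror r))))

    -- Testing for k first and then searching ys is at least as good as cost c on xs.
    Extracted : List A → List A → ℚ → Set
    Extracted xs ys c = ys ≡ [] ⊎ ∃ λ d → ys ⇓ d × weight xs + d ≤ c

    extract-leaf : ∀ ys zs → length (ys ++ k ∷ zs) ℕ.≤ 1 → ys ++ zs ≡ []
    extract-leaf [] [] _ = refl
    extract-leaf [] (_ ∷ _) (s≤s ())
    extract-leaf (_ ∷ []) _ (s≤s ())
    extract-leaf (_ ∷ _ ∷ _) _ (s≤s ())

    -- With `L = ys ++ us`, the side that holds `k` costs at least `a` plus 3θ plus `weight L`,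
    -- which is exactly the allowance for inserting `L`. The keys other than `k` weigh at most 7θ -
    -- 3θ. If `L` is empty, the cut already isolates `k`.
    extract-left : ∀ ys us qs {c d e} → weight (ys ++ k ∷ us ++ qs) ≤ 7θ →
      Extracted (ys ++ k ∷ us) (ys ++ us) d → 0ℚ ≤ d → qs ⇓ e →
      weight (ys ++ k ∷ us ++ qs) + (d + e) ≤ c → Extracted (ys ++ k ∷ us ++ qs) (ys ++ us ++ qs) c
    extract-left ys us qs {c} {d} {e} W≤7θ (inj₁ empty) d≥0 u h
      with ++-conicalˡ ys us empty | ++-conicalʳ ys us empty
    ... | refl | refl = inj₂ (e , u ,
      (linear (h ⊕ d≥0)
        (solve 4 (λ x e c d →
          x :+ e :+ (c :+ d) :=
          c :+ (x :+ (d :+ e) :+ con 0ℚ))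
          refl (weight (k ∷ qs)) e c d)))
    extract-left ys us qs {c} {d} {e} W≤7θ (inj₂ (a , l , h₁)) d≥0 u h =
      inj₂ (_ , subst (_⇓ (a + e + (θ + θ + θ) + weight (ys ++ us))) (++-assoc ys us qs)
        (Insertion.insert θ θ≥0 w≤3θ l qs
        (linear (W≤7θ ⊕ 3θ≤wk ⊕ ≤-reflexive (sym weight-W))
          (solve 5 (λ x y θ wk X →
            x :+ y :+ (θ :+ θ :+ θ :+ θ :+ θ :+ θ :+ θ :+ wk :+ X) :=
            θ :+ θ :+ θ :+ θ :+ (X :+ (θ :+ θ :+ θ) :+ (wk :+ (x :+ y))))
            refl (weight (ys ++ us)) (weight qs) θ (w k) (weight (ys ++ k ∷ us ++ qs))))
        u) ,
      (linear (h ⊕ h₁ ⊕ 3θ≤wk ⊕ ≤-reflexive (sym (weight-insert ys k us)))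
        (solve 9 (λ X a e θ x c d wk kx →
          X :+ (a :+ e :+ (θ :+ θ :+ θ) :+ x) :+ (c :+ d :+ wk :+ kx) :=
          c :+ (X :+ (d :+ e) :+ (kx :+ a) :+ (θ :+ θ :+ θ) :+ (wk :+ x)))
          refl (weight (ys ++ k ∷ us ++ qs)) a e θ (weight (ys ++ us)) c d (w k) (weight (ys ++ k ∷ us)))))
      where
      weight-W : weight (ys ++ k ∷ us ++ qs) ≡ w k + (weight (ys ++ us) + weight qs)
      weight-W = trans (weight-insert ys k (us ++ qs)) (cong (_+_ (w k))
        (trans (cong weight (sym (++-assoc ys us qs))) (weight-++ (ys ++ us) qs)))

    extract-right : ∀ ps vs zs {c d e} → weight (ps ++ vs ++ k ∷ zs) ≤ 7θ → ps ⇓ d →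
      Extracted (vs ++ k ∷ zs) (vs ++ zs) e → 0ℚ ≤ e →
      weight (ps ++ vs ++ k ∷ zs) + (d + e) ≤ c → Extracted (ps ++ vs ++ k ∷ zs) (ps ++ vs ++ zs) c
    extract-right ps vs zs {c} {d} {e} W≤7θ t (inj₁ empty) e≥0 h
      with ++-conicalˡ vs zs empty | ++-conicalʳ vs zs empty
    ... | refl | refl = inj₂ (d , subst (_⇓ d) (sym (++-identityʳ ps)) t ,
      (linear (h ⊕ e≥0)
        (solve 4 (λ x d c e →
          x :+ d :+ (c :+ e) :=
          c :+ (x :+ (d :+ e) :+ con 0ℚ))
          refl (weight (ps ++ [ k ])) d c e)))
    extract-right ps vs zs {c} {d} {e} W≤7θ t (inj₂ (a , l , h₁)) e≥0 h =
      inj₂ (_ , insertʳ ps (vs ++ zs)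
        (linear (W≤7θ ⊕ 3θ≤wk ⊕ ≤-reflexive (sym (weight-++ ps (vs ++ k ∷ zs)))
                 ⊕ ≤-reflexive (sym (weight-insert vs k zs)))
          (solve 6 (λ x y θ wk X kx →
            x :+ y :+ (θ :+ θ :+ θ :+ θ :+ θ :+ θ :+ θ :+ wk :+ X :+ kx) :=
            θ :+ θ :+ θ :+ θ :+ (X :+ (θ :+ θ :+ θ) :+ (y :+ kx) :+ (wk :+ x)))
            refl (weight (vs ++ zs)) (weight ps) θ (w k) (weight (ps ++ vs ++ k ∷ zs)) (weight (vs ++ k ∷ zs))))
        l t ,
      (linear (h ⊕ h₁ ⊕ 3θ≤wk ⊕ ≤-reflexive (sym (weight-insert vs k zs)))
        (solve 9 (λ X a d θ x c e wk kx →
          X :+ (a :+ d :+ (θ :+ θ :+ θ) :+ x) :+ (c :+ e :+ wk :+ kx) :=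
          c :+ (X :+ (d :+ e) :+ (kx :+ a) :+ (θ :+ θ :+ θ) :+ (wk :+ x)))
          refl (weight (ps ++ vs ++ k ∷ zs)) a d θ (weight (vs ++ zs)) c e (w k) (weight (vs ++ k ∷ zs)))))

    -- `X` stands for the whole list and `C` for the list without `j`; only their weights enter, so
    -- that both orders of `j` and `k` are served. Exchanging the two tests changes the cost by
    -- `w j` minus `w k`, which is not positive.
    extract-eq : ∀ X C ps j qs {c d} → weight X ≡ w k + weight (ps ++ j ∷ qs) →
      weight C ≡ w k + weight (ps ++ qs) → weight X ≤ 7θ → 0ℚ ≤ d → (weight C ≤ 7θ → Extracted C (ps ++ qs) d) →
      weight X + d ≤ c → Extracted X (ps ++ j ∷ qs) c
    extract-eq X C ps j qs {c} {d} X≡ C≡ X≤7θ d≥0 rec h = exchange (rec (≤-trans C≤X X≤7θ))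
      where
      C≤X : weight C ≤ weight X
      C≤X =
        (linear (≤-reflexive C≡ ⊕ ≤-reflexive (sym X≡) ⊕ w≥0 j ⊕ ≤-reflexive (sym (weight-insert ps j qs)))
          (solve 6 (λ C wk Z X wj jZ →
            C :+ (wk :+ Z :+ X :+ wj :+ jZ) :=
            X :+ (C :+ (wk :+ jZ) :+ con 0ℚ :+ (wj :+ Z)))
            refl (weight C) (w k) (weight (ps ++ qs)) (weight X) (w j) (weight (ps ++ j ∷ qs))))
      exchange : Extracted C (ps ++ qs) d → Extracted X (ps ++ j ∷ qs) c
      exchange (inj₁ empty) = inj₂ (0ℚ , leaf (singleton empty) ≤-refl , ≤-trans (+-monoʳ-≤ (weight X) d≥0) h)
        where
        singleton : ps ++ qs ≡ [] → length (ps ++ j ∷ qs) ℕ.≤ 1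
        singleton empty = ℕ.≤-reflexive (trans (length-++-sucʳ ps j qs) (cong (suc ∘ length) empty))
      exchange (inj₂ (a , l , h₁)) = inj₂ (_ , eq ps j qs refl l ≤-refl ,
        (linear (h ⊕ h₁ ⊕ w≤wk j ⊕ ≤-reflexive (sym C≡) ⊕ ≤-reflexive (weight-insert ps j qs))
          (solve 9 (λ X jZ a c d wk C wj Z →
            X :+ (jZ :+ a) :+ (c :+ d :+ wk :+ C :+ (wj :+ Z)) :=
            c :+ (X :+ d :+ (C :+ a) :+ wj :+ (wk :+ Z) :+ jZ))
            refl (weight X) (weight (ps ++ j ∷ qs)) a c d (w k) (weight C) (w j) (weight (ps ++ qs)))))

    extract : ∀ {xs c} ys zs → xs ≡ ys ++ k ∷ zs → weight (ys ++ k ∷ zs) ≤ 7θ → xs ⇓ c →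
      Extracted (ys ++ k ∷ zs) (ys ++ zs) c
    extract ys zs refl W≤7θ (leaf len _) = inj₁ (extract-leaf ys zs len)
    extract {c = c} ys zs refl W≤7θ (eq ps j qs {d} e t h) with ++-overlap ys ps e
    -- Coinciding positions mean that `j` is `k`: the root is the desired test already.
    ... | inj₁ ([] , refl , refl) = inj₂ (d , subst (λ l → (l ++ zs) ⇓ d) (++-identityʳ ys) t , h)
    ... | inj₁ (_ ∷ us , refl , refl) =
      subst (λ l → Extracted (ys ++ k ∷ us ++ j ∷ qs) l c) (++-assoc ys us (j ∷ qs))
        (extract-eq (ys ++ k ∷ us ++ j ∷ qs) (ys ++ k ∷ us ++ qs) (ys ++ us) j qs
          (trans (weight-insert ys k (us ++ j ∷ qs)) (cong (λ l → w k + weight l) (sym (++-assoc ys us (j ∷ qs)))))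
          (trans (weight-insert ys k (us ++ qs)) (cong (λ l → w k + weight l) (sym (++-assoc ys us qs))))
          W≤7θ (cost≥0 t)
          (λ C≤7θ → subst (λ l → Extracted (ys ++ k ∷ us ++ qs) l d) (sym (++-assoc ys us qs))
            (extract ys (us ++ qs) (++-assoc ys (k ∷ us) qs) C≤7θ t))
          h)
    ... | inj₂ (_ , us , refl , refl) =
      subst (λ l → Extracted ((ps ++ j ∷ us) ++ k ∷ zs) l c) (sym (++-assoc ps (j ∷ us) zs))
        (extract-eq ((ps ++ j ∷ us) ++ k ∷ zs) ((ps ++ us) ++ k ∷ zs) ps j (us ++ zs)
          (trans (weight-insert (ps ++ j ∷ us) k zs) (cong (λ l → w k + weight l) (++-assoc ps (j ∷ us) zs)))
          (trans (weight-insert (ps ++ us) k zs) (cong (λ l → w k + weight l) (++-assoc ps us zs)))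
          W≤7θ (cost≥0 t)
          (λ C≤7θ → subst (λ l → Extracted ((ps ++ us) ++ k ∷ zs) l d) (++-assoc ps us zs)
            (extract (ps ++ us) zs (sym (++-assoc ps us (k ∷ zs))) C≤7θ t))
          h)
    extract {c = c} ys zs refl W≤7θ (lt ps qs {d} {e} e≡ t u h) with ++-overlap ys ps e≡
    -- The cut falls immediately before `k`, which is thus the first key of the right side.
    ... | inj₁ ([] , refl , refl) =
      extract-right ys [] zs W≤7θ (subst (_⇓ d) (++-identityʳ ys) t)
        (extract [] zs refl (≤-trans (weight-suffix ys (k ∷ zs)) W≤7θ) u) (cost≥0 u) h
    ... | inj₁ (_ ∷ us , refl , refl) =
      extract-left ys us qs W≤7θ
        (extract ys us refl
          (≤-trans (weight-prefix (ys ++ k ∷ us) qs)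
            (subst (λ l → weight l ≤ 7θ) (sym (++-assoc ys (k ∷ us) qs)) W≤7θ)) t)
        (cost≥0 t) u h
    ... | inj₂ (b , us , refl , refl) =
      subst₂ (λ l m → Extracted l m c) (sym (++-assoc ps (b ∷ us) (k ∷ zs))) (sym (++-assoc ps (b ∷ us) zs))
        (extract-right ps (b ∷ us) zs W≤7θ′ t
          (extract (b ∷ us) zs refl (≤-trans (weight-suffix ps (b ∷ us ++ k ∷ zs)) W≤7θ′) u)
          (cost≥0 u) (subst (λ l → weight l + (d + e) ≤ c) (++-assoc ps (b ∷ us) (k ∷ zs)) h))
      where
      W≤7θ′ : weight (ps ++ b ∷ us ++ k ∷ zs) ≤ 7θ
      W≤7θ′ = subst (λ l → weight l ≤ 7θ) (++-assoc ps (b ∷ us) (k ∷ zs)) W≤7θ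

-- Auxiliary facts on sums, sorted lists and depths

+-interchange : ∀ a b c d → (a + b) + (c + d) ≡ (a + c) + (b + d)
+-interchange = solve 4 (λ a b c d → (a :+ b) :+ (c :+ d) := (a :+ c) :+ (b :+ d)) refl

AllPairs-++⁻ : ∀ {A : Set} {R : A → A → Set} xs {ys} → AllPairs R (xs ++ ys) →
  AllPairs R xs × AllPairs R ys × All (λ x → All (R x) ys) xs
AllPairs-++⁻ [] rs = [] , rs , []
AllPairs-++⁻ (x ∷ xs) (r ∷ rs) with AllPairs-++⁻ xs rs
... | ps , qs , pqs = All.++⁻ˡ xs r ∷ ps , qs , All.++⁻ʳ xs r ∷ pqs

-- The quotient in ℚ is normalised by a gcd that does not compute for a variable `d`; on
-- unnormalised fractions the equation is plain integer arithmetic.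
suc/1 : ∀ d → (+ suc d) / 1 ≡ 1ℚ + (+ d) / 1
suc/1 d = toℚᵘ-injective (begin
  toℚᵘ ((+ suc d) / 1)               ≈⟨ toℚᵘ-fromℚᵘ (ℚᵘ.mkℚᵘ (+ suc d) 0) ⟩
  ℚᵘ.mkℚᵘ (+ suc d) 0                ≈⟨ ℚᵘ.*≡* (cong (λ i → (+ 1 ℤ.+ i) ℤ.* + 1) (sym (ℤ.*-identityʳ (+ d)))) ⟩
  toℚᵘ 1ℚ ℚᵘ.+ ℚᵘ.mkℚᵘ (+ d) 0       ≈⟨ ℚᵘ.+-congʳ (toℚᵘ 1ℚ) (toℚᵘ-fromℚᵘ (ℚᵘ.mkℚᵘ (+ d) 0)) ⟨
  toℚᵘ 1ℚ ℚᵘ.+ toℚᵘ ((+ d) / 1)      ≈⟨ toℚᵘ-homo-+ 1ℚ ((+ d) / 1) ⟨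
  toℚᵘ (1ℚ + (+ d) / 1)              ∎)
  where open ℚᵘ.≃-Reasoning

sumFin-tabulate : ∀ {A : Set} n (f : A → ℚ) (g : Fin n → A) → Weight.weight f (tabulate g) ≡ sumFin n (f ∘ g)
sumFin-tabulate zero f g = refl
sumFin-tabulate (suc n) f g = cong (_+_ (f (g Fin.zero))) (sumFin-tabulate n f (g ∘ Fin.suc))

-- Correspondence between search trees and cost bounds

module Trees {n : ℕ} (w : Fin n → ℚ) (w≥0 : ∀ k → 0ℚ ≤ w k) where

  open KeyLists w w≥0
  open Weight using () renaming (weight to total)
  open import Data.List.Membership.DecPropositional (_≟_ {n}) using (_∈?_)

  Sorted : List (Fin n) → Set
  Sorted = AllPairs _<_

  Answers : Tree n → Fin n → Set
  Answers t q = proj₁ (search t q) ≡ q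

  -- An equation between whole search results, so that one proof serves both the label and the
  -- depth.
  Enters : Tree n → Tree n → Fin n → Set
  Enters t u q = search t q ≡ (proj₁ (search u q) , suc (depth u q))

  eqT-yes : ∀ k t u → Enters (eqT k t u) t k
  eqT-yes k t u with k ≟ k
  ... | yes _ = refl
  ... | no k≢k = ⊥-elim (k≢k refl)

  eqT-no : ∀ k t u {q} → q ≢ k → Enters (eqT k t u) u q
  eqT-no k t u {q} q≢k with q ≟ k
  ... | yes q≡k = ⊥-elim (q≢k q≡k)
  ... | no _ = refl

  ltT-yes : ∀ k t u {q} → q < k → Enters (ltT k t u) t q
  ltT-yes k t u {q} q<k with q <? k
  ... | yes _ = refl
  ... | no q≮k = ⊥-elim (q≮k q<k)

  ltT-no : ∀ k t u {q} → ¬ q < k → Enters (ltT k t u) u q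
  ltT-no k t u {q} q≮k with q <? k
  ... | yes q<k = ⊥-elim (q≮k q<k)
  ... | no _ = refl

  answers-down : ∀ t u {q} → Enters t u q → Answers t q → Answers u q
  answers-down t u en ans = trans (sym (cong proj₁ en)) ans

  answers-up : ∀ t u {q} → Enters t u q → Answers u q → Answers t q
  answers-up t u en ans = trans (cong proj₁ en) ans

  -- Opaque, because with-abstraction would otherwise normalise the rational arithmetic of path costs.
  opaque

    pathCost : Tree n → Fin n → ℚ
    pathCost t q = w q * ((+ depth t q) / 1)

    pathCost≥0 : ∀ t q → 0ℚ ≤ pathCost t q
    pathCost≥0 t q = subst (_≤ pathCost t q) (*-zeroʳ (w q))
      (*-monoˡ-≤-nonNeg (w q) {{nonNegative (w≥0 q)}}
        (nonNegative⁻¹ ((+ depth t q) / 1) {{normalize-nonNeg (depth t q) 1}}))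

    cost≡total : ∀ t → cost w t ≡ total (pathCost t) (allFin n)
    cost≡total t = sym (sumFin-tabulate n (pathCost t) id)

    pathCost-leaf : ∀ k q → pathCost (leaf k) q ≡ 0ℚ
    pathCost-leaf k q = *-zeroʳ (w q)

    pathCost-enters : ∀ t u {q} → Enters t u q → pathCost t q ≡ w q + pathCost u q
    pathCost-enters t u {q} en =
      trans (cong (λ r → w q * ((+ proj₂ r) / 1)) en)
        (trans (cong (w q *_) (suc/1 (depth u q)))
          (trans (*-distribˡ-+ (w q) 1ℚ _) (cong (_+ pathCost u q) (*-identityʳ (w q)))))

  total-enters : ∀ t u {xs} → All (Enters t u) xs → total (pathCost t) xs ≡ weight xs + total (pathCost u) xs
  total-enters t u [] = refl
  total-enters t u {q ∷ qs} (en ∷ ens) = trans (cong₂ _+_ (pathCost-enters t u en) (total-enters t u ens))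
    (+-interchange (w q) (pathCost u q) (weight qs) (total (pathCost u) qs))

  sorted-delete : ∀ ys k zs → Sorted (ys ++ k ∷ zs) → Sorted (ys ++ zs) × All (_≢ k) (ys ++ zs)
  sorted-delete ys k zs s with AllPairs-++⁻ ys s
  ... | sy , k<zs ∷ sz , y< =
    AllPairs.++⁺ sy sz (All.map All.tail y<) ,
    All.++⁺ (All.map (λ y<all y≡k → Fin.<-irrefl y≡k (All.head y<all)) y<)
            (All.map (λ k<z z≡k → Fin.<-irrefl (sym z≡k) k<z) k<zs)

  sorted-cut : ∀ k {xs} → Sorted xs →
    ∃₂ λ ys zs → xs ≡ ys ++ zs × All (_< k) ys × All (λ z → ¬ z < k) zs
  sorted-cut k [] = [] , [] , refl , [] , []
  sorted-cut k {x ∷ xs} (x<xs ∷ s) with x <? k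
  ... | no x≮k = [] , x ∷ xs , refl , [] , x≮k ∷ All.map (λ x<y y<k → x≮k (Fin.<-trans x<y y<k)) x<xs
  ... | yes x<k with sorted-cut k s
  ... | ys , zs , refl , ys<k , zs≮k = x ∷ ys , zs , refl , x<k ∷ ys<k , zs≮k

  sorted-constant : ∀ {k xs} → Sorted xs → All (k ≡_) xs → length xs ℕ.≤ 1
  sorted-constant [] _ = z≤n
  sorted-constant (_ ∷ []) _ = s≤s z≤n
  sorted-constant ((x<y ∷ _) ∷ _ ∷ _) (refl ∷ refl ∷ _) = ⊥-elim (Fin.<-irrefl refl x<y)

  total-eqT : ∀ ys k zs t u → Sorted (ys ++ k ∷ zs) → total (pathCost (eqT k t u)) (ys ++ k ∷ zs) ≡
    weight (ys ++ k ∷ zs) + (pathCost t k + total (pathCost u) (ys ++ zs))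
  total-eqT ys k zs t u s =
    trans (Weight.weight-insert (pathCost (eqT k t u)) ys k zs)
      (trans (cong₂ _+_ (pathCost-enters (eqT k t u) t (eqT-yes k t u))
                        (total-enters (eqT k t u) u (All.map (eqT-no k t u) (proj₂ (sorted-delete ys k zs s)))))
        (trans (+-interchange (w k) (pathCost t k) (weight (ys ++ zs)) (total (pathCost u) (ys ++ zs)))
          (cong (_+ (pathCost t k + total (pathCost u) (ys ++ zs))) (sym (weight-insert ys k zs)))))

  total-ltT : ∀ ys zs k t u → All (_< k) ys → All (λ z → ¬ z < k) zs →
    total (pathCost (ltT k t u)) (ys ++ zs) ≡
    weight (ys ++ zs) + (total (pathCost t) ys + total (pathCost u) zs)
  total-ltT ys zs k t u ys<k zs≮k =
    trans (Weight.weight-++ (pathCost (ltT k t u)) ys zs)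
      (trans (cong₂ _+_ (total-enters (ltT k t u) t (All.map (ltT-yes k t u) ys<k))
                        (total-enters (ltT k t u) u (All.map (ltT-no k t u) zs≮k)))
        (trans (+-interchange (weight ys) (total (pathCost t) ys) (weight zs) (total (pathCost u) zs))
          (cong (_+ (total (pathCost t) ys + total (pathCost u) zs)) (sym (weight-++ ys zs)))))

  -- A test for a key outside the list sends every query to its "no" child and is dropped. The "yes"
  -- child of any other equal-to test is reached by one key only, and its cost is discarded.
  tree⇒⇓ : ∀ t {xs} → Sorted xs → All (Answers t) xs → xs ⇓ total (pathCost t) xs
  tree⇒⇓ (leaf k) {xs} s ans =
    leaf (sorted-constant s ans) (Weight.weight≥0 (pathCost (leaf k)) (pathCost≥0 (leaf k)) xs)
  tree⇒⇓ (eqT k t u) {xs} s ans with k ∈? xs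
  ... | no k∉xs = weaken
      (subst (total (pathCost u) xs ≤_) (sym (total-enters (eqT k t u) u enters))
      (linear (weight≥0 xs)
        (solve 2 (λ c x →
          c :+ x :=
          x :+ c :+ con 0ℚ)
          refl (total (pathCost u) xs) (weight xs))))
      (tree⇒⇓ u s (All.zipWith (λ (en , an) → answers-down (eqT k t u) u en an) (enters , ans)))
    where
    enters : All (Enters (eqT k t u) u) xs
    enters = All.map (λ k≢q → eqT-no k t u (k≢q ∘ sym)) (All.¬Any⇒All¬ xs k∉xs)
  ... | yes k∈xs with ∈-∃++ k∈xs
  ... | ys , zs , refl with sorted-delete ys k zs s
  ... | s′ , ≢k =
    eq ys k zs refl
      (tree⇒⇓ u s′ (All.zipWith (λ (q≢k , an) → answers-down (eqT k t u) u (eqT-no k t u q≢k) an)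
        (≢k , All.++⁺ (All.++⁻ˡ ys ans) (All.tail (All.++⁻ʳ ys ans)))))
      (subst (weight (ys ++ k ∷ zs) + total (pathCost u) (ys ++ zs) ≤_) (sym (total-eqT ys k zs t u s))
      (linear (pathCost≥0 t k)
        (solve 3 (λ x c p →
          x :+ c :+ p :=
          x :+ (p :+ c) :+ con 0ℚ)
          refl (weight (ys ++ k ∷ zs)) (total (pathCost u) (ys ++ zs)) (pathCost t k))))
  tree⇒⇓ (ltT k t u) {xs} s ans with sorted-cut k s
  ... | ys , zs , refl , ys<k , zs≮k with AllPairs-++⁻ ys s
  ... | sy , sz , _ =
    lt ys zs refl
      (tree⇒⇓ t sy (All.zipWith (λ (q<k , an) → answers-down (ltT k t u) t (ltT-yes k t u q<k) an) (ys<k , All.++⁻ˡ ys ans)))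
      (tree⇒⇓ u sz (All.zipWith (λ (q≮k , an) → answers-down (ltT k t u) u (ltT-no k t u q≮k) an) (zs≮k , All.++⁻ʳ ys ans)))
      (≤-reflexive (sym (total-ltT ys zs k t u ys<k zs≮k)))

  Realises : Tree n → List (Fin n) → ℚ → Set
  Realises t xs c = All (Answers t) xs × total (pathCost t) xs ≤ c

  realises-eqT : ∀ ys k zs u {c d} → Sorted (ys ++ k ∷ zs) → Realises u (ys ++ zs) d →
    weight (ys ++ k ∷ zs) + d ≤ c → Realises (eqT k (leaf k) u) (ys ++ k ∷ zs) c
  realises-eqT ys k zs u {c} {d} s (ans , d≥) h =
    All.++⁺ (All.++⁻ˡ ys up) (answers-up (eqT k (leaf k) u) (leaf k) (eqT-yes k (leaf k) u) refl ∷ All.++⁻ʳ ys up) ,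
    subst (_≤ c) (sym (total-eqT ys k zs (leaf k) u s))
    (linear (≤-reflexive (pathCost-leaf k k) ⊕ d≥ ⊕ h)
      (solve 5 (λ x p p′ d c →
        x :+ (p :+ p′) :+ (con 0ℚ :+ d :+ c) :=
        c :+ (p :+ p′ :+ (x :+ d)))
        refl (weight (ys ++ k ∷ zs)) (pathCost (leaf k) k) (total (pathCost u) (ys ++ zs)) d c))
    where
    up : All (Answers (eqT k (leaf k) u)) (ys ++ zs)
    up = All.zipWith (λ (q≢k , an) → answers-up (eqT k (leaf k) u) u (eqT-no k (leaf k) u q≢k) an)
      (proj₂ (sorted-delete ys k zs s) , ans)

  -- The key k labels the leaf of an empty list, which no query reaches.
  ⇓⇒tree : Fin n → ∀ {xs c} → Sorted xs → xs ⇓ c → ∃ λ t → Realises t xs c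
  ⇓⇒tree k {[]} s (leaf _ c≥0) = leaf k , [] , c≥0
  ⇓⇒tree k {a ∷ []} s (leaf _ c≥0) = leaf a , refl ∷ [] , ≤-trans (≤-reflexive (cong (_+ 0ℚ) (pathCost-leaf a a))) c≥0
  ⇓⇒tree k {_ ∷ _ ∷ _} s (leaf (s≤s ()) c≥0)
  ⇓⇒tree k s (eq ys a zs e t h) with e
  ... | refl with ⇓⇒tree k (proj₁ (sorted-delete ys a zs s)) t
  ... | u , r = eqT a (leaf a) u , realises-eqT ys a zs u s r h
  -- A comparison is named by the first key to its right; where there is none, it is dropped, which
  -- cannot raise the cost.
  ⇓⇒tree k {c = c} s (lt ys [] {d} {e} e≡ t u h) with trans e≡ (++-identityʳ ys)
  ... | refl with ⇓⇒tree k s t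
  ... | v , ans , d≥ = v , ans ,
    (linear (d≥ ⊕ cost≥0 u ⊕ weight≥0 ys ⊕ h)
      (solve 5 (λ p d e x c →
        p :+ (d :+ e :+ x :+ c) :=
        c :+ (p :+ con 0ℚ :+ con 0ℚ :+ (x :+ (d :+ e))))
        refl (total (pathCost v) ys) d e (weight ys) c))
  -- The test is strict, so the threshold `b` itself goes to the "no" child, together with the rest
  -- of `zs`.
  ⇓⇒tree k {c = c} s (lt ys zs@(b ∷ _) {d} {e} e≡ t u h) with e≡
  ... | refl with AllPairs-++⁻ ys s
  ... | sy , sz@(b<zs ∷ _) , ys<zs with ⇓⇒tree k sy t | ⇓⇒tree k sz u
  ... | t′ , ans , d≥ | u′ , ans′ , e≥ =
    ltT b t′ u′ ,
    All.++⁺ (All.zipWith (λ (q<b , an) → answers-up (ltT b t′ u′) t′ (ltT-yes b t′ u′ q<b) an) (ys<b , ans))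
            (All.zipWith (λ (q≮b , an) → answers-up (ltT b t′ u′) u′ (ltT-no b t′ u′ q≮b) an) (zs≮b , ans′)) ,
    subst (_≤ c) (sym (total-ltT ys zs b t′ u′ ys<b zs≮b))
    (linear (d≥ ⊕ e≥ ⊕ h)
      (solve 6 (λ x p q d e c →
        x :+ (p :+ q) :+ (d :+ e :+ c) :=
        c :+ (p :+ q :+ (x :+ (d :+ e))))
        refl (weight (ys ++ zs)) (total (pathCost t′) ys) (total (pathCost u′) zs) d e c))
    where
    ys<b : All (_< b) ys
    ys<b = All.map All.head ys<zs
    zs≮b : All (λ z → ¬ z < b) zs
    zs≮b = Fin.<-irrefl refl ∷ All.map (λ b<z z<b → Fin.<-asym b<z z<b) b<zs

-- Optimality of a tree with an equal-to test at the root

optimal-eq-root : ∀ {n} → n ≥ 2 → (w : Fin n → ℚ) (w≥0 : ∀ k → 0ℚ ≤ w k) (k : Fin n) → (∀ a → w a ≤ w k) →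
  (θ : ℚ) → 0ℚ ≤ θ → w k ≡ θ + θ + θ → sumFin n w ≤ θ + θ + θ + θ + θ + θ + θ →
  Σ (Tree n) λ t → Optimal w t × RootIsEqualTo t
optimal-eq-root {n} n≥2 w w≥0 k w≤wk θ θ≥0 wk≡3θ W≤7θ = conclude (∈-∃++ (∈-allFin k))
  where
  open KeyLists w w≥0
  open Trees w w≥0
  open Extraction θ θ≥0 k wk≡3θ w≤wk

  sorted : Sorted (allFin n)
  sorted = AllPairs.tabulate⁺-< id

  W≤7θ′ : ∀ {xs} → allFin n ≡ xs → weight xs ≤ 7θ
  W≤7θ′ refl = ≤-trans (≤-reflexive (sumFin-tabulate n w id)) W≤7θ

  cost≡total′ : ∀ {xs} t → allFin n ≡ xs → cost w t ≡ Weight.weight (pathCost t) xs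
  cost≡total′ t refl = cost≡total t

  -- Two or more keys exclude the empty alternative of `Extracted`.
  nonempty-rest : ∀ ys zs → allFin n ≡ ys ++ k ∷ zs → ys ++ zs ≢ []
  nonempty-rest ys zs keys empty = ℕ.<⇒≱ n≥2 (ℕ.≤-reflexive
    (trans (sym (length-tabulate id)) (trans (cong length keys)
      (trans (length-++-sucʳ ys k zs) (cong (suc ∘ length) empty)))))

  -- The tree tests for `k` and then searches the other keys at least cost. Every correct tree is
  -- turned by `extract` into one of this shape at no greater cost.
  assemble : ∀ ys zs {c} → allFin n ≡ ys ++ k ∷ zs → (∀ {d} → (ys ++ zs) ⇓ d → c ≤ d) →
    (∃ λ u → Realises u (ys ++ zs) c) → Σ (Tree n) λ t → Optimal w t × RootIsEqualTo t
  assemble ys zs {c} keys least (u , realises) =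
    eqT k (leaf k) u , (correct , λ t t-correct →
      ≤-trans (≤-trans (≤-reflexive (cost≡total′ (eqT k (leaf k) u) keys)) (proj₂ root))
        (≤-trans (bound (extract ys zs refl (W≤7θ′ keys) (tree⇒⇓ t sorted′ (All.universal t-correct _))))
          (≤-reflexive (sym (cost≡total′ t keys))))) , tt
    where
    sorted′ : Sorted (ys ++ k ∷ zs)
    sorted′ = subst Sorted keys sorted
    root : Realises (eqT k (leaf k) u) (ys ++ k ∷ zs) (weight (ys ++ k ∷ zs) + c)
    root = realises-eqT ys k zs u sorted′ realises ≤-refl
    correct : Correct (eqT k (leaf k) u)
    correct q = All.lookup (proj₁ root) (subst (q ∈_) keys (∈-allFin q))
    bound : ∀ {d} → Extracted (ys ++ k ∷ zs) (ys ++ zs) d → weight (ys ++ k ∷ zs) + c ≤ d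
    bound (inj₁ empty) = ⊥-elim (nonempty-rest ys zs keys empty)
    bound (inj₂ (_ , t , h)) = ≤-trans (+-monoʳ-≤ (weight (ys ++ k ∷ zs)) (least t)) h

  conclude : (∃₂ λ ys zs → allFin n ≡ ys ++ [ k ] ++ zs) → Σ (Tree n) λ t → Optimal w t × RootIsEqualTo t
  conclude (ys , zs , keys) =
    let c , t , least = least-cost (ys ++ zs)
    in assemble ys zs keys least (⇓⇒tree k (proj₁ (sorted-delete ys k zs (subst Sorted keys sorted))) t)

argmax-Fin : ∀ {n} (w : Fin n → ℚ) → Fin n → ∃ λ k → ∀ a → w a ≤ w k
argmax-Fin {n} w k₀ =
  argmax w k₀ (allFin n) , λ a → All.lookup (f[xs]≤f[argmax] k₀ (allFin n)) (∈-allFin a)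

theorem1 : (n : ℕ) → n ≥ 2 → (w : Fin n → ℚ) → (∀ k → 0ℚ ≤ w k) →
    (Σ (Fin n) λ k → ((+ 3) / 7) * sumFin n w ≤ w k) →
    Σ (Tree n) λ t → Optimal w t × RootIsEqualTo t
theorem1 n n≥2 w w≥0 (k₀ , heavy) with argmax-Fin w k₀
-- The heaviest key `k` inherits the threshold from `k₀`. With θ a third of `w k`, the total weight
-- is at most 7/3 of `w k`, that is 7θ.
... | k , w≤wk = optimal-eq-root n≥2 w w≥0 k w≤wk ((+ 1) / 3 * w k)
  (*-monoˡ-≤-nonNeg ((+ 1) / 3) (w≥0 k)) (three-thirds (w k)) (begin
    sumFin n w
      ≡⟨ solve 1 (λ x → x := con ((+ 7) / 3) :* (con ((+ 3) / 7) :* x)) refl (sumFin n w) ⟩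
    (+ 7) / 3 * ((+ 3) / 7 * sumFin n w)
      ≤⟨ *-monoˡ-≤-nonNeg ((+ 7) / 3) (≤-trans heavy (w≤wk k₀)) ⟩
    (+ 7) / 3 * w k
      ≡⟨ seven-thirds (w k) ⟩
    _ ∎)
  where
  open ≤-Reasoning
  three-thirds : ∀ x → let y = (+ 1) / 3 * x in x ≡ y + y + y
  three-thirds = solve 1 (λ x → let y = con ((+ 1) / 3) :* x in x := y :+ y :+ y) refl
  seven-thirds : ∀ x → let y = (+ 1) / 3 * x in (+ 7) / 3 * x ≡ y + y + y + y + y + y + y
  seven-thirds = solve 1 (λ x → let y = con ((+ 1) / 3) :* x in
    con ((+ 7) / 3) :* x := y :+ y :+ y :+ y :+ y :+ y :+ y) refl
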